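{- Let $p\ge q\ge 1$ be integers. Let $P^{\mathrm{comp}}_{p,q}\subseteq\mathbb{R}^{\mathcal{I}_{p,q}}\times\mathbb{R}^{\mathcal{I}_{p,q}}$ be the polytope of all $(z,w)$ satisfying $$\begin{aligned} w_{i+1,j+1}-w_{i,j+1}&\ge 0 &&\text{for } i\in[p-1]_0,\ j\in[q(i+1)-1]_0,\\ w_{i,j}-w_{i+1,j+1}&\ge 0 &&\text{for } (i,j)\in\mathcal{I}_{p,q},\ i<p,\\ w_{p,1}&\le 1,\\ w_{i,j}-w_{i-1,j}-z_{i,j}+z_{i,j+1}&\le 0 &&\text{for } (i,j)\in\mathcal{I}_{p,q},\\ z_{i,j}-w_{i,j}&\le 0 &&\text{for } (i,j)\in\mathcal{I}_{p,q},\\ w_{i,q(i)}&\ge 0 &&\text{for } i\in[p], \end{aligned}$$ where $z_{i,j}$ and $w_{i,j}$ are read as $0$ whenever $j>q(i)$. Then $P^{\mathrm{comp}}_{p,q}$ is an extended formulation of the packing orbitope $O^{\le}_{p,q}$. Moreover, the face of $P^{\mathrm{comp}}_{p,q}$ defined by $w_{1,1}=1$ is an extended formulation of the partitioning orbitope $O^{=}_{p,q}$.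
   Context: Notation: $[n]=\{1,\dots,n\}$, $[n]_0=\{0,1,\dots,n\}$, $q(i)=\min\{i,q\}$ (so $q(0)=0$), $\mathcal{I}_{p,q}=\{(i,j)\in[p]\times[q] : i\ge j\}$. The packing orbitope $O^{\le}_{p,q}$ (resp. the partitioning orbitope $O^{=}_{p,q}$) is the convex hull of all 0/1-matrices of size $p\times q$ whose columns are in lexicographically decreasing (i.e., non-increasing, with row 1 the most significant position) order and that have at most one (resp. exactly one) 1-entry per row. Since no such matrix has a 1 above its main diagonal, the entries $(i,j)$ with $i<j$ are dropped and $O^{=}_{p,q}\subseteq O^{\le}_{p,q}$ are regarded as subsets of $\mathbb{R}^{\mathcal{I}_{p,q}}$. An extended formulation of a polytope $Q$ is a linear description of a polytope $P$ in a higher-dimensional space (by abuse of language, also $P$ itself) such that $Q$ is a linear projection of $P$, i.e., the image of $P$ under some linear map. -}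

module Defs where

open import Algebra.Bundles using (CommutativeRing)
open import Algebra.Module.Bundles.Raw using (RawLeftModule)
import Algebra.Module.Construct.TensorUnit as TensorUnit
open import Algebra.Module.Morphism.Structures using (module LeftModuleMorphisms)
import Algebra.Definitions.RawMonoid as RawMonoidDefinitions
open import Data.Bool.Base using (Bool; true; if_then_else_) renaming (_<_ to _<ᵇ_)
open import Data.Fin.Base using (Fin; toℕ; fromℕ<)
import Data.Fin.Base as Fin
open import Data.Fin.Properties using (toℕ-fromℕ<)
open import Data.Nat.Base using (ℕ; zero; suc; pred; _⊓_)
import Data.Nat.Base as ℕ
open import Data.Nat.Properties using (_<?_; _≤?_)
open import Data.Product using (Σ-syntax; ∃-syntax; ∃!; _×_)
open import Data.Sum.Base using (_⊎_; inj₁; inj₂)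
open import Data.Vec.Base using (Vec; tabulate)
import Data.Vec.Relation.Binary.Lex.Strict as Lex
open import Function.Base using (_∘_)
open import Function.Bundles using (_⇔_)
open import Level using (Level; _⊔_) renaming (suc to lsuc)
open import Relation.Binary.Core using (Rel)
open import Relation.Binary.PropositionalEquality.Core as ≡ using (_≡_)
open import Relation.Binary.Structures using (IsDecTotalOrder)
open import Relation.Nullary.Decidable.Core using (yes; no)
open import Relation.Nullary.Negation.Core using (¬_)
open import Relation.Unary using (Pred; _∈_)

-- The scalars.  The standard library has no real numbers, so everything is
-- done over an arbitrary ordered field; ℝ (with its classical, decidable,
-- total order) and ℚ are instances.

record OrderedField c ℓ₁ ℓ₂ : Set (lsuc (c ⊔ ℓ₁ ⊔ ℓ₂)) where
  field
    commutativeRing : CommutativeRing c ℓ₁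
  open CommutativeRing commutativeRing public
  infix 4 _≤_
  field
    _≤_             : Rel Carrier ℓ₂
    isDecTotalOrder : IsDecTotalOrder _≈_ _≤_
    0≉1             : ¬ 0# ≈ 1#
    inverse         : ∀ x → ¬ x ≈ 0# → ∃[ y ] x * y ≈ 1#
    +-monoʳ-≤       : ∀ x {y z} → y ≤ z → x + y ≤ x + z
    *-nonNeg        : ∀ {x y} → 0# ≤ x → 0# ≤ y → 0# ≤ x * y

-- [p] × [q] is represented by Fin p × Fin q, so the 1-based indices
-- are i and j below.  Irrelevance of the proof makes an element of 𝓘 p q
-- determined by its row and column.

record 𝓘 (p q : ℕ) : Set where
  constructor entry
  field
    row        : Fin p
    col        : Fin q
    .col≤row   : toℕ col ℕ.≤ toℕ row

  i j : ℕ
  i = suc (toℕ row)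
  j = suc (toℕ col)

-- 0/1-matrices

Matrix : ℕ → ℕ → Set
Matrix p q = Fin p → Fin q → Bool

column : ∀ {p q} → Matrix p q → Fin q → Vec Bool p
column A j = tabulate (λ i → A i j)

ColumnsDecreasing : ∀ {p q} → Matrix p q → Set
ColumnsDecreasing A =
  ∀ {j j′} → j Fin.≤ j′ → Lex.Lex-≤ _≡_ _<ᵇ_ (column A j′) (column A j)

AtMostOnePerRow : ∀ {p q} → Matrix p q → Set
AtMostOnePerRow A = ∀ i {j j′} → A i j ≡ true → A i j′ ≡ true → j ≡ j′

ExactlyOnePerRow : ∀ {p q} → Matrix p q → Set
ExactlyOnePerRow A = ∀ i → ∃! _≡_ λ j → A i j ≡ true

module _ {c ℓ₁ ℓ₂} (K : OrderedField c ℓ₁ ℓ₂) where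

  open OrderedField K
  open RawMonoidDefinitions +-rawMonoid using (sum)

  private
    variable
      X Y : Set
      ℓ ℓ′ : Level

  -- The space K^X; K^A × K^B is K^(A ⊎ B).

  Space : Set → Set c
  Space X = X → Carrier

  infix 4 _≋_
  _≋_ : Rel (Space X) ℓ₁
  u ≋ v = ∀ e → u e ≈ v e

  space : Set → RawLeftModule Carrier c ℓ₁
  space X = record
    { Carrierᴹ = Space X
    ; _≈ᴹ_     = _≋_
    ; _+ᴹ_     = λ u v e → u e + v e
    ; _*ₗ_     = λ a v e → a * v e
    ; 0ᴹ       = λ _ → 0#
    ; -ᴹ_      = λ v e → - v e
    }

  IsLinear : (Space X → Space Y) → Set (c ⊔ ℓ₁)
  IsLinear {X} {Y} =
    LeftModuleMorphisms.IsLeftModuleHomomorphism (space X) (space Y)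

  IsLinearForm : (Space X → Carrier) → Set (c ⊔ ℓ₁)
  IsLinearForm {X} = LeftModuleMorphisms.IsLeftModuleHomomorphism
    (space X) (TensorUnit.rawLeftModule {R = rawRing})

  IsPolyhedron : Pred (Space X) ℓ → Set (c ⊔ ℓ₁ ⊔ ℓ₂ ⊔ ℓ)
  IsPolyhedron {X} P =
    ∃[ m ] Σ[ a ∈ (Fin m → Space X → Carrier) ] Σ[ b ∈ (Fin m → Carrier) ]
      (∀ k → IsLinearForm (a k)) × (∀ v → v ∈ P ⇔ (∀ k → a k v ≤ b k))

  IsBounded : Pred (Space X) ℓ → Set (c ⊔ ℓ₂ ⊔ ℓ)
  IsBounded P = ∃[ B ] ∀ {v} → v ∈ P → ∀ e → - B ≤ v e × v e ≤ B

  IsPolytope : Pred (Space X) ℓ → Set (c ⊔ ℓ₁ ⊔ ℓ₂ ⊔ ℓ)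
  IsPolytope P = IsPolyhedron P × IsBounded P

  IsExtendedFormulation : Pred (Space X) ℓ → Pred (Space Y) ℓ′ →
                          Set (c ⊔ ℓ₁ ⊔ ℓ₂ ⊔ ℓ ⊔ ℓ′)
  IsExtendedFormulation {X} {Y = Y} P Q =
    IsPolytope P ×
    (Σ[ π ∈ (Space X → Space Y) ]
      IsLinear π × (∀ x → x ∈ Q ⇔ (∃[ v ] v ∈ P × π v ≋ x)))

  -- P ∩ { a = b } is a face of P when a ≤ b is valid for P.

  IsValid : Pred (Space X) ℓ → (Space X → Carrier) → Carrier →
            Set (c ⊔ ℓ₁ ⊔ ℓ₂ ⊔ ℓ)
  IsValid P a b = IsLinearForm a × (∀ {v} → v ∈ P → a v ≤ b)

  Face : Pred (Space X) ℓ → (Space X → Carrier) → Carrier →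
         Pred (Space X) (ℓ₁ ⊔ ℓ)
  Face P a b v = v ∈ P × a v ≈ b

  ConvexHull : Pred (Space X) ℓ → Pred (Space X) (c ⊔ ℓ₁ ⊔ ℓ₂ ⊔ ℓ)
  ConvexHull {X} S x =
    ∃[ n ] Σ[ μ ∈ (Fin n → Carrier) ] Σ[ s ∈ (Fin n → Space X) ]
      (∀ k → 0# ≤ μ k) × sum μ ≈ 1# × (∀ k → s k ∈ S) ×
      x ≋ (λ e → sum (λ k → μ k * s k e))

  module _ (p q : ℕ) where

    restrict : Matrix p q → Space (𝓘 p q)
    restrict A e = if A (𝓘.row e) (𝓘.col e) then 1# else 0#

    PackingOrbitope : Pred (Space (𝓘 p q)) (c ⊔ ℓ₁ ⊔ ℓ₂)
    PackingOrbitope = ConvexHull λ x → ∃[ A ]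
      ColumnsDecreasing A × AtMostOnePerRow A × x ≋ restrict A

    PartitioningOrbitope : Pred (Space (𝓘 p q)) (c ⊔ ℓ₁ ⊔ ℓ₂)
    PartitioningOrbitope = ConvexHull λ x → ∃[ A ]
      ColumnsDecreasing A × ExactlyOnePerRow A × x ≋ restrict A

    -- The entry of v at the 1-based position (i , j), read as 0 outside 𝓘 p q.

    infix 10 _⟨_,_⟩
    _⟨_,_⟩ : Space (𝓘 p q) → ℕ → ℕ → Carrier
    v ⟨ suc i , suc j ⟩ with i <? p | j <? q | j ≤? i
    ... | yes i<p | yes j<q | yes j≤i =
          v (entry (fromℕ< i<p) (fromℕ< j<q)
              (≡.subst₂ ℕ._≤_ (≡.sym (toℕ-fromℕ< j<q)) (≡.sym (toℕ-fromℕ< i<p)) j≤i))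
    ... | _ | _ | _ = 0#
    v ⟨ _ , _ ⟩ = 0#

    cap : ℕ → ℕ
    cap i = i ⊓ q

    record CompactSystem (z w : Space (𝓘 p q)) : Set ℓ₂ where
      field
        -- i ∈ [p-1]₀ and j ∈ [q(i+1)-1]₀, written without subtraction
        w-vertical : ∀ i j → i ℕ.< p → j ℕ.< cap (suc i) →
          0# ≤ w ⟨ suc i , suc j ⟩ - w ⟨ i , suc j ⟩
        w-diagonal : ∀ (e : 𝓘 p q) → let open 𝓘 e in i ℕ.< p →
          0# ≤ w ⟨ i , j ⟩ - w ⟨ suc i , suc j ⟩
        w-top : w ⟨ p , 1 ⟩ ≤ 1#
        zw-lower : ∀ (e : 𝓘 p q) → let open 𝓘 e in
          w ⟨ i , j ⟩ - w ⟨ pred i , j ⟩ - z ⟨ i , j ⟩ + z ⟨ i , suc j ⟩ ≤ 0#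
        zw-upper : ∀ (e : 𝓘 p q) → let open 𝓘 e in
          z ⟨ i , j ⟩ - w ⟨ i , j ⟩ ≤ 0#
        w-nonNeg : ∀ i → 1 ℕ.≤ i → i ℕ.≤ p →
          0# ≤ w ⟨ i , cap i ⟩

    CompactPolytope : Pred (Space (𝓘 p q ⊎ 𝓘 p q)) ℓ₂
    CompactPolytope v = CompactSystem (v ∘ inj₁) (v ∘ inj₂)

    w₁₁ : Space (𝓘 p q ⊎ 𝓘 p q) → Carrier
    w₁₁ v = (v ∘ inj₂) ⟨ 1 , 1 ⟩

{-# OPTIONS --safe #-}
module Submission where

-- Read w i j as the probability that after i rows at least j columns are in
-- use, and z i j as the probability that the 1 of row i lies in a column ≥ j;
-- the projection sends (z , w) to z i j - z i (j + 1).  At the point of a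
-- vertex these probabilities are 0 or 1.  Conversely, the system says that
--   w (i - 1) j ≤ w i j ≤ w (i - 1) (j - 1)   (with w i 0 = 1, w 0 j = 0),
--   z i (j + 1) + w i j - w (i - 1) j ≤ z i j ≤ w i j,
-- so each coordinate lies between two affine functions of earlier ones, whose
-- values are 0 or 1 whenever the earlier coordinates are those of a vertex.
-- Placing every coordinate at its lower or upper bound according to
-- independent random bits with suitable probabilities hence gives a random
-- vertex whose expectation is the given point.

open import Defs
open import Data.Nat.Base using (ℕ) renaming (_≤_ to _≤ⁿ_)
open import Data.Product.Base using (_×_)
import Algebra.Module.Construct.TensorUnit as TensorUnit
open import Algebra.Module.Morphism.Structures using (module LeftModuleMorphisms)
import Algebra.Properties.Group as GroupProperties
import Algebra.Properties.Ring as RingProperties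
import Algebra.Properties.Semiring.Sum as SumProperties
import Algebra.Solver.Ring.NaturalCoefficients.Default as SemiringSolver
open import Data.Bool.Base
  using (Bool; true; false; if_then_else_; _∧_; _∨_; not; f<t) renaming (_<_ to _<ᵇ_)
open import Data.Bool.Properties using (∨-zeroʳ; not-¬; ¬-not)
open import Data.Empty.Irrelevant using () renaming (⊥-elim to ⊥-elim-irr)
open import Data.Fin.Base as Fin using (Fin; zero; suc; toℕ; fromℕ<; splitAt)
open import Data.Fin.Properties
  using (toℕ-fromℕ<; fromℕ<-toℕ; toℕ<n; toℕ-injective; splitAt-↑ˡ; splitAt-↑ʳ)
open import Data.List.Base using (List; []; _∷_; map; _++_; upTo; filter; cartesianProduct)
open import Data.List.Membership.Propositional using (_∉_) renaming (_∈_ to _∈ˡ_)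
open import Data.List.Membership.Propositional.Properties
  using (∈-++⁺ˡ; ∈-++⁺ʳ; ∈-map⁺; ∈-upTo⁺; ∈-filter⁺; ∈-filter⁻; ∈-cartesianProduct⁺)
open import Data.List.Relation.Unary.Any using (here; there)
open import Data.Nat.Base as ℕ using (zero; suc)
import Data.Nat.Properties as ℕ
open import Data.Product.Base using (Σ-syntax; ∃-syntax; _,_; proj₁; proj₂)
open import Data.Product.Properties using () renaming (≡-dec to ×-≡-dec)
open import Data.Sum.Base as Sum using (_⊎_; inj₁; inj₂; [_,_]′)
open import Data.Sum.Properties using () renaming (≡-dec to ⊎-≡-dec)
open import Data.Unit.Base using (tt)
open import Data.Vec.Base using (tabulate)
import Data.Vec.Relation.Binary.Lex.Strict as Lex
open import Function.Base using (_∘_; const; _$_)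
open import Function.Bundles using (_⇔_; mk⇔; module Equivalence)
open import Level using (Level; _⊔_)
open import Relation.Binary.Bundles using (Poset)
open import Relation.Binary.Definitions using (DecidableEquality)
open import Relation.Binary.PropositionalEquality as ≡ using (_≡_; _≢_)
import Relation.Binary.Reasoning.PartialOrder as PosetReasoning
open import Relation.Binary.Structures using (IsDecTotalOrder)
open import Relation.Nullary.Decidable using (Dec; yes; no; does; ¬?)
open import Relation.Nullary.Negation.Core using (¬_; contradiction)
open import Relation.Unary using (Pred; _∈_; _∩_)

-- The bits that fix the two bounds of a coordinate never include its own bit. Its expected value is
-- therefore the mean of the expected bounds, and these are the bounds at the given point, by
-- induction and because they are affine. The one bound that is not visibly Boolean is
-- `z i (j + 1) + w i j - w (i - 1) j`. At a pattern, a 1 of row `i` to the right of column `j`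
-- requires column `j` to be in use before row `i`, so the first term can be 1 only when the
-- difference is 0. The partitioning case meets an obstacle: in a convex combination every listed
-- point must be a vertex, even one of weight 0. A coordinate equal to its upper bound must
-- therefore get no random bit at all, which is why bits are drawn only where the upper bound is not
-- certain.

module Patterns where

  -- Boolean patterns and their 0/1-matrices

  open import Data.Nat.Base using (_+_; _∸_; _≤_; _<_; z≤n; s≤s; s≤s⁻¹)
  open import Data.Nat.Properties
  open ≡ using (refl; sym; trans; cong; cong₂; subst; subst₂)

  private
    variable
      i j k q : ℕ

  _⊑_ : Bool → Bool → Set
  a ⊑ b = a ≡ true → b ≡ true

  ∨-introʳ : ∀ a {b} → b ⊑ (a ∨ b)
  ∨-introʳ a refl = ∨-zeroʳ a

  ∸-suc : ∀ {m n} → m < n → n ∸ m ≡ suc (n ∸ suc m)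
  ∸-suc = +-∸-assoc 1

  -- W i j: after i rows, at least j columns are in use.
  -- Z i j: row i has its 1 in one of the columns j, j + 1, ….
  record IsPattern (q : ℕ) (W Z : ℕ → ℕ → Bool) : Set where
    field
      W-left  : ∀ i → W i 0 ≡ true
      W-first : ∀ j → W 0 (suc j) ≡ false
      W-keep  : ∀ {i j} → W i j ⊑ W (suc i) j
      W-open  : ∀ {i j} → W (suc i) (suc j) ⊑ W i j
      Z-last  : ∀ i → Z (suc i) (suc q) ≡ false
      Z-keep  : ∀ {i j} → Z (suc i) (suc (suc j)) ⊑ Z (suc i) (suc j)
      Z-used  : ∀ {i j} → Z (suc i) (suc j) ⊑ W (suc i) (suc j)
      Z-new   : ∀ {i j} → j < q → W (suc i) (suc j) ≡ true → W i (suc j) ≡ false →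
                Z (suc i) (suc j) ≡ true

    W-drop : W i (suc j) ⊑ W i j
    W-drop = W-open ∘ W-keep

    W-drop* : ∀ {j′} → j ≤ j′ → W i j′ ⊑ W i j
    W-drop* {j′ = zero}   z≤n  = λ e → e
    W-drop* {j} {j′ = suc j′} j≤j′ with m≤n⇒m<n∨m≡n j≤j′
    ... | inj₁ j<j′ = W-drop* (s≤s⁻¹ j<j′) ∘ W-drop
    ... | inj₂ refl = λ e → e

    Z-keep* : ∀ {j′} → j ≤ j′ → Z (suc i) (suc j′) ⊑ Z (suc i) (suc j)
    Z-keep* {j′ = zero}   z≤n  = λ e → e
    Z-keep* {j} {j′ = suc j′} j≤j′ with m≤n⇒m<n∨m≡n j≤j′
    ... | inj₁ j<j′ = Z-keep* (s≤s⁻¹ j<j′) ∘ Z-keep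
    ... | inj₂ refl = λ e → e

    -- `W-open` leads down the diagonal to row 0, where `W-first` applies.
    W-triangular : i ≤ j → W i (suc j) ≡ false
    W-triangular {zero}  _ = W-first _
    W-triangular {suc i} {suc j} (s≤s i≤j) = ¬-not λ e → not-¬ (W-triangular i≤j) (W-open e)

    Z-triangular : i < j → Z (suc i) (suc j) ≡ false
    Z-triangular i<j = ¬-not λ e → not-¬ (W-triangular i<j) (Z-used e)

  -- Matrices from patterns

  module _ {W Z : ℕ → ℕ → Bool} (pat : IsPattern q W Z) where
    open IsPattern pat

    -- The place where a row of `Z` drops from true to false. Rows and columns count from 0 here and
    -- from 1 in `Z`.
    mark : ℕ → ℕ → Bool
    mark i j = Z (suc i) (suc j) ∧ not (Z (suc i) (suc (suc j)))

    mark⇒Z : mark i j ⊑ Z (suc i) (suc j)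
    mark⇒Z {i} {j} e with Z (suc i) (suc j)
    ... | true = refl

    mark⇒¬Z : mark i j ≡ true → Z (suc i) (suc (suc j)) ≡ false
    mark⇒¬Z {i} {j} e with Z (suc i) (suc j) | Z (suc i) (suc (suc j))
    ... | true | false = refl

    -- In the row where `W` turns true, `Z-new` puts the 1 in column `j` or to its right; further
    -- right is impossible, since `Z-used` and `W-open` would make the column used one row earlier.
    -- The bound `j < q` is there because `Z` stops at column `q` while `W` need not.
    mark-opened : j < q → W i (suc j) ≡ true → ∃[ i′ ] i′ < i × mark i′ j ≡ true
    mark-opened {i = zero}  j<q e = contradiction e (not-¬ (W-first _))
    mark-opened {j} {suc i} j<q e with W i (suc j) in eq
    ... | true  = let i′ , i′<i , m = mark-opened j<q eq in i′ , m≤n⇒m≤1+n i′<i , m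
    ... | false = i , ≤-refl , cong₂ _∧_ (Z-new j<q e eq)
      (cong not (¬-not λ z → not-¬ eq (W-open (Z-used z))))

    -- A 1 in column `j′` needs every column to its left in use before that row, by `W-open`, and a
    -- used column has been opened by a 1.
    mark-ordered : ∀ {j′} → j < j′ → j′ < q → mark i j′ ≡ true → ∃[ i′ ] i′ < i × mark i′ j ≡ true
    mark-ordered j<j′ j′<q m = mark-opened (<-trans j<j′ j′<q)
      (W-drop* j<j′ (W-open (Z-used (mark⇒Z m))))

    mark-unique-≤ : ∀ {j′} → mark i j ≡ true → mark i j′ ≡ true → j′ ≤ j
    mark-unique-≤ m m′ = ≮⇒≥ λ j<j′ → not-¬ (mark⇒¬Z m) (Z-keep* j<j′ (mark⇒Z m′))

    -- Walk right along the row until `Z` drops, which `Z-last` forces; `k` counts the columns left.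
    mark-exists : ∀ k j → k + j ≡ q → Z (suc i) (suc j) ≡ true → ∃[ j′ ] j′ < q × mark i j′ ≡ true
    mark-exists zero    j refl e = contradiction e (not-¬ (Z-last _))
    mark-exists {i} (suc k) j refl e with Z (suc i) (suc (suc j)) in eq
    ... | true  = mark-exists k (suc j) (+-suc k j) eq
    ... | false = j , s≤s (m≤n+m j k) , cong₂ _∧_ e (cong not eq)

    matrix : ∀ p → Matrix p q
    matrix p r c = mark (toℕ r) (toℕ c)

  -- If `g` has a true entry, its first one precedes every true entry of `f`, so it is the first
  -- difference; otherwise both vectors are constantly false.
  Lex-tabulate : ∀ n (f g : ℕ → Bool) → (∀ i → f i ≡ true → ∃[ i′ ] i′ < i × g i′ ≡ true) →
    Lex.Lex-≤ _≡_ _<ᵇ_ (tabulate {n = n} (f ∘ toℕ)) (tabulate {n = n} (g ∘ toℕ))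
  Lex-tabulate zero    f g h = Lex.base tt
  Lex-tabulate (suc n) f g h with f 0 in eq | g 0 in eq′
  ... | true  | _     = contradiction (proj₁ (proj₂ (h 0 eq))) n≮0
  ... | false | true  = Lex.this f<t refl
  ... | false | false = Lex.next refl (Lex-tabulate n (f ∘ suc) (g ∘ suc) λ i e → shift (h (suc i) e))
    where
    shift : ∀ {i} → ∃[ i′ ] i′ < suc i × g i′ ≡ true → ∃[ i′ ] i′ < i × g (suc i′) ≡ true
    shift (zero   , _       , e) = contradiction e (not-¬ eq′)
    shift (suc i′ , s≤s i′<i , e) = i′ , i′<i , e

  Lex-refl : ∀ n (f : Fin n → Bool) → Lex.Lex-≤ _≡_ _<ᵇ_ (tabulate f) (tabulate f)
  Lex-refl zero    f = Lex.base tt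
  Lex-refl (suc n) f = Lex.next refl (Lex-refl n (f ∘ suc))

  module _ {W Z : ℕ → ℕ → Bool} (pat : IsPattern q W Z) (p : ℕ) where
    open IsPattern pat

    matrix-columnsDecreasing : ColumnsDecreasing (matrix pat p)
    matrix-columnsDecreasing {j} {j′} j≤j′ with m≤n⇒m<n∨m≡n j≤j′
    ... | inj₁ j<j′ = Lex-tabulate p _ _ λ i → mark-ordered pat j<j′ (toℕ<n j′)
    ... | inj₂ j≡j′ rewrite toℕ-injective j≡j′ = Lex-refl p _

    matrix-atMostOne : AtMostOnePerRow (matrix pat p)
    matrix-atMostOne i m m′ =
      toℕ-injective (≤-antisym (mark-unique-≤ pat m′ m) (mark-unique-≤ pat m m′))

    matrix-exactlyOne : (∀ {i} → i < p → Z (suc i) 1 ≡ true) → ExactlyOnePerRow (matrix pat p)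
    matrix-exactlyOne full i =
      let j , j<q , m = mark-exists pat q 0 (+-identityʳ q) (full (toℕ<n i))
          m′ = trans (cong (mark pat (toℕ i)) (toℕ-fromℕ< j<q)) m
      in fromℕ< j<q , m′ , matrix-atMostOne i m′

  -- Patterns from matrices

  -- Were `g` false up to `i`, the first true entry of `f` would make `f` the larger vector.
  Lex-true : ∀ {n} (f g : Fin n → Bool) → Lex.Lex-≤ _≡_ _<ᵇ_ (tabulate f) (tabulate g) →
    ∀ i → f i ≡ true → ∃[ i′ ] i′ Fin.≤ i × g i′ ≡ true
  Lex-true {suc n} f g l zero e with f zero | g zero in eq
  Lex-true {suc n} f g (Lex.next refl l) zero e | true | true = zero , z≤n , eq
  Lex-true {suc n} f g l (suc i) e with f zero | g zero in eq
  Lex-true {suc n} f g l (suc i) e | _ | true = zero , z≤n , eq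
  Lex-true {suc n} f g (Lex.next _ l) (suc i) e | _ | false =
    let i′ , i′≤i , e′ = Lex-true (f ∘ suc) (g ∘ suc) l i e in suc i′ , s≤s i′≤i , e′

  module _ {p q} (A : Matrix p q) where

    at : ℕ → ℕ → Bool
    at i j with i <? p | j <? q
    ... | yes i<p | yes j<q = A (fromℕ< i<p) (fromℕ< j<q)
    ... | _       | _       = false

    at-toℕ : ∀ r c → at (toℕ r) (toℕ c) ≡ A r c
    at-toℕ r c with toℕ r <? p | toℕ c <? q
    ... | yes r<p | yes c<q = cong₂ A (fromℕ<-toℕ r r<p) (fromℕ<-toℕ c c<q)
    ... | no r≮p  | _       = contradiction (toℕ<n r) r≮p
    ... | yes _   | no c≮q  = contradiction (toℕ<n c) c≮q

    at-true : at i j ≡ true → ∃[ r ] ∃[ c ] toℕ r ≡ i × toℕ c ≡ j × A r c ≡ true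
    at-true {i} {j} e with i <? p | j <? q
    ... | yes i<p | yes j<q = _ , _ , toℕ-fromℕ< i<p , toℕ-fromℕ< j<q , e

    at-range : at i j ≡ true → j < q
    at-range e with at-true e
    ... | _ , c , _ , refl , _ = toℕ<n c

    module _ (one : AtMostOnePerRow A) where

      at-unique : ∀ {j′} → at i j ≡ true → at i j′ ≡ true → j ≡ j′
      at-unique e e′ with at-true e | at-true e′
      ... | r , c , refl , refl , a | r′ , c′ , r≡ , refl , a′ =
        cong toℕ (one r a (subst (λ x → A x c′ ≡ true) (toℕ-injective r≡) a′))

      -- The lexicographic order yields a 1 in column `j` no later than row `i`; in row `i` itself
      -- it would be a second 1.
      at-ordered : ColumnsDecreasing A → at i (suc j) ≡ true → ∃[ i′ ] i′ < i × at i′ j ≡ true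
      at-ordered {i} {j} dec e with at-true e
      ... | r , c , refl , c≡ , a = toℕ r′ , ≤∧≢⇒< r′≤r r′≢r , at-r′
        where
        j<q : j < q
        j<q = <-trans ≤-refl (at-range e)

        later = Lex-true _ _ (dec (subst₂ _≤_ (sym (toℕ-fromℕ< j<q)) (sym c≡) (n≤1+n j))) r a
        r′ = proj₁ later
        r′≤r = proj₁ (proj₂ later)

        at-r′ : at (toℕ r′) j ≡ true
        at-r′ = trans (cong (at (toℕ r′)) (sym (toℕ-fromℕ< j<q)))
                      (trans (at-toℕ r′ (fromℕ< j<q)) (proj₂ (proj₂ later)))

        r′≢r : toℕ r′ ≢ toℕ r
        r′≢r eq = 1+n≢n (sym (at-unique (trans (cong (λ x → at x j) (sym eq)) at-r′) e))

  module FromMarks (q : ℕ) (a : ℕ → ℕ → Bool)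
    (ordered : ∀ {i j} → a i (suc j) ≡ true → ∃[ i′ ] i′ < i × a i′ j ≡ true)
    (unique  : ∀ {i j j′} → a i j ≡ true → a i j′ ≡ true → j ≡ j′)
    (range   : ∀ {i j} → a i j ≡ true → j < q) where

    used : ℕ → ℕ → Bool
    used i       zero    = true
    used zero    (suc j) = false
    used (suc i) (suc j) = a i j ∨ used i (suc j)

    -- The second argument is the number of columns searched from `j` on, which makes the recursion
    -- structural; `right` passes `q ∸ j`, enough to reach the last column.
    among : ℕ → ℕ → ℕ → Bool
    among i zero    j = false
    among i (suc k) j = a i j ∨ among i k (suc j)

    right : ℕ → ℕ → Bool
    right (suc i) (suc j) = among i (q ∸ j) j
    right _       _       = false

    used⁺ : ∀ {i′} → i′ < i → a i′ j ≡ true → used i (suc j) ≡ true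
    used⁺ {suc i} {j} i′<1+i e with m≤n⇒m<n∨m≡n (s≤s⁻¹ i′<1+i)
    ... | inj₁ i′<i = ∨-introʳ (a i j) (used⁺ i′<i e)
    ... | inj₂ refl rewrite e = refl

    used⁻ : used i (suc j) ≡ true → ∃[ i′ ] i′ < i × a i′ j ≡ true
    used⁻ {suc i} {j} e with a i j in eq
    ... | true  = i , ≤-refl , eq
    ... | false = let i′ , i′<i , e′ = used⁻ e in i′ , m≤n⇒m≤1+n i′<i , e′

    used-keep : ∀ i j → used i j ⊑ used (suc i) j
    used-keep i zero    e = refl
    used-keep i (suc j) e = ∨-introʳ (a i j) e

    used-open : ∀ i j → used (suc i) (suc j) ⊑ used i j
    used-open i zero    e = refl
    used-open i (suc j) e =
      let i′ , i′<1+i , e′ = used⁻ {suc i} {suc j} e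
          i″ , i″<i′ , e″ = ordered e′
      in used⁺ (<-≤-trans i″<i′ (s≤s⁻¹ i′<1+i)) e″

    among⁻ : ∀ k → among i k j ≡ true → ∃[ j′ ] j ≤ j′ × a i j′ ≡ true
    among⁻ {i} {j} (suc k) e with a i j in eq
    ... | true  = j , ≤-refl , eq
    ... | false = let j′ , j<j′ , e′ = among⁻ k e in j′ , <⇒≤ j<j′ , e′

    among⁺ : ∀ k m → m < k → a i (m + j) ≡ true → among i k j ≡ true
    among⁺ (suc k) zero    _         e rewrite e = refl
    among⁺ {i} {j} (suc k) (suc m) (s≤s m<k) e =
      ∨-introʳ (a i j) (among⁺ k m m<k (trans (cong (a i) (+-suc m j)) e))

    -- If the 1 is further right, `used-open` shows that column `j` was in use before row `i`.
    among-used : ∀ k → among i k j ⊑ used (suc i) (suc j)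
    among-used {i} {j} (suc k) e with a i j
    ... | true  = refl
    ... | false = used-open i (suc j) (among-used k e)

    right-step : ∀ i → j < q → right (suc i) (suc j) ≡ a i j ∨ right (suc i) (suc (suc j))
    right-step {j} i j<q = cong (λ k → among i k j) (∸-suc j<q)

    right-keep : ∀ i j → right (suc i) (suc (suc j)) ⊑ right (suc i) (suc j)
    right-keep i j e with suc j ≤? q
    ... | yes j<q = trans (right-step i j<q) (∨-introʳ (a i j) e)
    ... | no  j≮q rewrite m≤n⇒m∸n≡0 (<⇒≤ (≰⇒> j≮q)) = contradiction e λ ()

    right-new : ∀ i j → used (suc i) (suc j) ≡ true → used i (suc j) ≡ false →
                right (suc i) (suc j) ≡ true
    right-new i j e e′ with a i j in eq
    ... | true  = trans (right-step i (range eq)) (cong (_∨ right (suc i) (suc (suc j))) eq)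
    ... | false = contradiction e (not-¬ e′)

    isPattern : IsPattern q used right
    isPattern = record
      { W-left  = λ _ → refl
      ; W-first = λ _ → refl
      ; W-keep  = λ {i} {j} → used-keep i j
      ; W-open  = used-open _ _
      ; Z-last  = λ i → cong (λ k → among i k q) (n∸n≡0 q)
      ; Z-keep  = right-keep _ _
      ; Z-used  = λ {i} {j} → among-used (q ∸ j)
      ; Z-new   = λ _ → right-new _ _
      }

    right-disjoint : a i j ≡ true → right (suc i) (suc (suc j)) ≡ false
    right-disjoint {i} {j} e = ¬-not λ e′ →
      let j′ , j<j′ , e″ = among⁻ (q ∸ suc j) e′ in <⇒≢ j<j′ (unique e e″)

    right-full : a i j ≡ true → right (suc i) 1 ≡ true
    right-full {i} {j} e = among⁺ q j (range e) (trans (cong (a i) (+-identityʳ j)) e)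

  -- Patterns from bits: a set bit puts a coordinate at its upper bound.

  Coordinate : Set
  Coordinate = (ℕ × ℕ) ⊎ (ℕ × ℕ)

  Bits : Set
  Bits = Coordinate → Bool

  module FromBits (q : ℕ) where

    Wᵇ : Bits → ℕ → ℕ → Bool
    Wᵇ b i       zero    = true
    Wᵇ b zero    (suc j) = false
    Wᵇ b (suc i) (suc j) = if b (inj₁ (i , j)) then Wᵇ b i j else Wᵇ b i (suc j)

    mutual
      tailᵇ : ℕ → ℕ → ℕ → Bits → Bool
      tailᵇ i zero    j b = false
      tailᵇ i (suc k) j b =
        if b (inj₂ (i , j)) then Wᵇ b (suc i) (suc j) else lowerᵇ i k j b

      -- Boolean form of `z i (j + 1) + w i j - w (i - 1) j`: the two disjuncts exclude each other,
      -- as `indicator-lower` makes precise.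
      lowerᵇ : ℕ → ℕ → ℕ → Bits → Bool
      lowerᵇ i k j b = tailᵇ i k (suc j) b ∨ (Wᵇ b (suc i) (suc j) ∧ not (Wᵇ b i (suc j)))

    Zᵇ : Bits → ℕ → ℕ → Bool
    Zᵇ b (suc i) (suc j) = tailᵇ i (q ∸ j) j b
    Zᵇ b _       _       = false

    mutual
      -- Consecutive rows interlace: whichever bound the bit selects in the new row is at most the
      -- entry up and to the left, and that entry is at most the one below it. This ties the
      -- induction to `Wᵇ-keep`.
      Wᵇ-drop : ∀ b i j → Wᵇ b i (suc j) ⊑ Wᵇ b i j
      Wᵇ-drop b i       zero    e = refl
      Wᵇ-drop b (suc i) (suc j) e with b (inj₁ (i , suc j))
      ... | true  = Wᵇ-keep b i (suc j) e
      ... | false = Wᵇ-keep b i (suc j) (Wᵇ-drop b i (suc j) e)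

      Wᵇ-keep : ∀ b i j → Wᵇ b i j ⊑ Wᵇ b (suc i) j
      Wᵇ-keep b i zero    e = refl
      Wᵇ-keep b i (suc j) e with b (inj₁ (i , j))
      ... | true  = Wᵇ-drop b i j e
      ... | false = e

    Wᵇ-open : ∀ b i j → Wᵇ b (suc i) (suc j) ⊑ Wᵇ b i j
    Wᵇ-open b i j e with b (inj₁ (i , j))
    ... | true  = e
    ... | false = Wᵇ-drop b i j e

    tailᵇ-used : ∀ b i k j → tailᵇ i k j b ⊑ Wᵇ b (suc i) (suc j)
    tailᵇ-used b i (suc k) j e with b (inj₂ (i , j))
    ... | true = e
    ... | false with tailᵇ i k (suc j) b in eq
    ...   | true = Wᵇ-drop b (suc i) (suc j) (tailᵇ-used b i k (suc j) eq)
    ...   | false with Wᵇ b (suc i) (suc j)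
    ...     | true = refl

    tailᵇ-keep : ∀ b i k j → tailᵇ i k (suc j) b ⊑ tailᵇ i (suc k) j b
    tailᵇ-keep b i k j e with b (inj₂ (i , j))
    ... | true  = Wᵇ-drop b (suc i) (suc j) (tailᵇ-used b i k (suc j) e)
    ... | false rewrite e = refl

    tailᵇ-new : ∀ b i k j → Wᵇ b (suc i) (suc j) ≡ true → Wᵇ b i (suc j) ≡ false →
                tailᵇ i (suc k) j b ≡ true
    tailᵇ-new b i k j e e′ with b (inj₂ (i , j))
    ... | true  = e
    ... | false rewrite e | e′ = ∨-zeroʳ _

    isPatternᵇ : ∀ b → IsPattern q (Wᵇ b) (Zᵇ b)
    isPatternᵇ b = record
      { W-left  = λ _ → refl
      ; W-first = λ _ → refl
      ; W-keep  = λ {i} {j} → Wᵇ-keep b i j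
      ; W-open  = Wᵇ-open b _ _
      ; Z-last  = λ i → cong (λ k → tailᵇ i k q b) (n∸n≡0 q)
      ; Z-keep  = Z-keep _ _
      ; Z-used  = λ {i} {j} → tailᵇ-used b i (q ∸ j) j
      ; Z-new   = Z-new _ _
      }
      where
      Z-keep : ∀ i j → Zᵇ b (suc i) (suc (suc j)) ⊑ Zᵇ b (suc i) (suc j)
      Z-keep i j e with suc j ≤? q
      ... | yes j<q rewrite ∸-suc j<q = tailᵇ-keep b i (q ∸ suc j) j e
      ... | no  j≮q rewrite m≤n⇒m∸n≡0 (<⇒≤ (≰⇒> j≮q)) = contradiction e λ ()

      Z-new : ∀ i j → j < q → Wᵇ b (suc i) (suc j) ≡ true → Wᵇ b i (suc j) ≡ false →
              Zᵇ b (suc i) (suc j) ≡ true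
      Z-new i j j<q rewrite ∸-suc j<q = tailᵇ-new b i (q ∸ suc j) j

    -- The first bit copies `Wᵇ b i 0`, which is true, and the second copies the result to `Z`. This
    -- is what gives each row of a sample a 1 in the partitioning case.
    Zᵇ-full : ∀ b i → 1 ≤ q → b (inj₁ (i , 0)) ≡ true → b (inj₂ (i , 0)) ≡ true →
              Zᵇ b (suc i) 1 ≡ true
    Zᵇ-full b i (s≤s _) e e′ rewrite e | e′ = refl

    -- Source of independence: with `tailᵇ-local` it shows that the bounds of a coordinate do not
    -- read its own bit.
    Wᵇ-local : ∀ {b b′} i j → (∀ {i′ j′} → i′ < i → b (inj₁ (i′ , j′)) ≡ b′ (inj₁ (i′ , j′))) →
               Wᵇ b i j ≡ Wᵇ b′ i j
    Wᵇ-local i       zero    h = refl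
    Wᵇ-local zero    (suc j) h = refl
    Wᵇ-local {b} {b′} (suc i) (suc j) h
      rewrite h {i} {j} ≤-refl
            | Wᵇ-local {b} {b′} i j (h ∘ m≤n⇒m≤1+n)
            | Wᵇ-local {b} {b′} i (suc j) (h ∘ m≤n⇒m≤1+n) = refl

    tailᵇ-local : ∀ {b b′} i k j → (∀ {x} → b (inj₁ x) ≡ b′ (inj₁ x)) →
                  (∀ {j′} → j ≤ j′ → b (inj₂ (i , j′)) ≡ b′ (inj₂ (i , j′))) →
                  tailᵇ i k j b ≡ tailᵇ i k j b′
    tailᵇ-local i zero    j h h′ = refl
    tailᵇ-local {b} {b′} i (suc k) j h h′
      rewrite h′ {j} ≤-refl
            | Wᵇ-local {b} {b′} (suc i) (suc j) (λ _ → h)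
            | Wᵇ-local {b} {b′} i (suc j) (λ _ → h)
            | tailᵇ-local {b} {b′} i k (suc j) h (λ j<j′ → h′ (<⇒≤ j<j′)) = refl

-- Ordered field arithmetic and two-point means

module OrderedFieldProperties {c ℓ₁ ℓ₂} (K : OrderedField c ℓ₁ ℓ₂) where

  open OrderedField K
  open IsDecTotalOrder isDecTotalOrder public
    using (total; antisym; _≟_; _≤?_; ≤-respˡ-≈; ≤-respʳ-≈; isPartialOrder)
    renaming (refl to ≤-refl; trans to ≤-trans; reflexive to ≤-reflexive)
  open GroupProperties +-group using (//-rightDividesˡ; //-rightDividesʳ; ⁻¹-involutive)
  open RingProperties ring using (-1*x≈-x; -‿distribʳ-*)
  open SemiringSolver commutativeSemiring using (solve; _:=_; _:+_; _:*_)

  poset : Poset c ℓ₁ ℓ₂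
  poset = record { isPartialOrder = isPartialOrder }

  open PosetReasoning poset

  +-monoˡ-≤ : ∀ z {x y} → x ≤ y → x + z ≤ y + z
  +-monoˡ-≤ z {x} {y} x≤y = begin
    x + z ≈⟨ +-comm x z ⟩
    z + x ≤⟨ +-monoʳ-≤ z x≤y ⟩
    z + y ≈⟨ +-comm z y ⟩
    y + z ∎

  +-mono-≤ : ∀ {x y u v} → x ≤ y → u ≤ v → x + u ≤ y + v
  +-mono-≤ {y = y} {u} x≤y u≤v = ≤-trans (+-monoˡ-≤ u x≤y) (+-monoʳ-≤ y u≤v)

  +-cancelʳ-≤ : ∀ z {x y} → x + z ≤ y + z → x ≤ y
  +-cancelʳ-≤ z {x} {y} x+z≤y+z = begin
    x           ≈⟨ //-rightDividesʳ z x ⟨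
    x + z - z   ≤⟨ +-monoˡ-≤ (- z) x+z≤y+z ⟩
    y + z - z   ≈⟨ //-rightDividesʳ z y ⟩
    y           ∎

  +-cancelʳ-≈ : ∀ z {x y} → x + z ≈ y + z → x ≈ y
  +-cancelʳ-≈ z eq = antisym (+-cancelʳ-≤ z (≤-reflexive eq)) (+-cancelʳ-≤ z (≤-reflexive (sym eq)))

  ≤-resp-≈ : ∀ {x x′ y y′} → x ≈ x′ → y ≈ y′ → x ≤ y → x′ ≤ y′
  ≤-resp-≈ x≈x′ y≈y′ x≤y = ≤-respˡ-≈ x≈x′ (≤-respʳ-≈ y≈y′ x≤y)

  x-y+y≈x : ∀ x y → x - y + y ≈ x
  x-y+y≈x x y = //-rightDividesˡ y x

  0≤y-x⇒x≤y : ∀ {x y} → 0# ≤ y - x → x ≤ y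
  0≤y-x⇒x≤y {x} {y} h = ≤-resp-≈ (+-identityˡ x) (x-y+y≈x y x) (+-monoˡ-≤ x h)

  x≤y⇒0≤y-x : ∀ {x y} → x ≤ y → 0# ≤ y - x
  x≤y⇒0≤y-x {x} {y} h =
    +-cancelʳ-≤ x (≤-resp-≈ (sym (+-identityˡ x)) (sym (x-y+y≈x y x)) h)

  x-y≤0⇒x≤y : ∀ {x y} → x - y ≤ 0# → x ≤ y
  x-y≤0⇒x≤y {x} {y} h = ≤-resp-≈ (x-y+y≈x x y) (+-identityˡ y) (+-monoˡ-≤ y h)

  x≤y⇒x-y≤0 : ∀ {x y} → x ≤ y → x - y ≤ 0#
  x≤y⇒x-y≤0 {x} {y} h =
    +-cancelʳ-≤ y (≤-resp-≈ (sym (x-y+y≈x x y)) (sym (+-identityˡ y)) h)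

  private
    rearrange : ∀ w w′ z z′ → w - w′ - z + z′ + (z + w′) ≈ z′ + w
    rearrange w w′ z z′ = begin-equality
      w - w′ - z + z′ + (z + w′)
        ≈⟨ solve 6 (λ a b c d e f → a :+ b :+ c :+ d :+ (e :+ f) :=
             (b :+ f) :+ (c :+ e) :+ (d :+ a)) refl w (- w′) (- z) z′ z w′ ⟩
      (- w′ + w′) + (- z + z) + (z′ + w)
        ≈⟨ +-congʳ (+-cong (-‿inverseˡ w′) (-‿inverseˡ z)) ⟩
      0# + 0# + (z′ + w)
        ≈⟨ +-congʳ (+-identityˡ 0#) ⟩
      0# + (z′ + w)
        ≈⟨ +-identityˡ _ ⟩
      z′ + w ∎

  transpose⁺ : ∀ {w w′ z z′} → w - w′ - z + z′ ≤ 0# → z′ + w ≤ z + w′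
  transpose⁺ {w} {w′} {z} {z′} h =
    ≤-resp-≈ (rearrange w w′ z z′) (+-identityˡ _) (+-monoˡ-≤ (z + w′) h)

  transpose⁻ : ∀ {w w′ z z′} → z′ + w ≤ z + w′ → w - w′ - z + z′ ≤ 0#
  transpose⁻ {w} {w′} {z} {z′} h =
    +-cancelʳ-≤ (z + w′) (≤-resp-≈ (sym (rearrange w w′ z z′)) (sym (+-identityˡ _)) h)

  x≤0⇒0≤-x : ∀ {x} → x ≤ 0# → 0# ≤ - x
  x≤0⇒0≤-x {x} h = ≤-respʳ-≈ (+-identityˡ (- x)) (x≤y⇒0≤y-x h)

  0≤-x⇒x≤0 : ∀ {x} → 0# ≤ - x → x ≤ 0#
  0≤-x⇒x≤0 {x} h = 0≤y-x⇒x≤y (≤-respʳ-≈ (sym (+-identityˡ (- x))) h)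

  neg-mono-≤ : ∀ {x y} → x ≤ y → - y ≤ - x
  neg-mono-≤ {x} {y} x≤y = 0≤y-x⇒x≤y (≤-respʳ-≈ (begin-equality
    y - x     ≈⟨ +-comm y (- x) ⟩
    - x + y   ≈⟨ +-congˡ (⁻¹-involutive y) ⟨
    - x - - y ∎) (x≤y⇒0≤y-x x≤y))

  neg-cancel-≤ : ∀ {x y} → - y ≤ - x → x ≤ y
  neg-cancel-≤ {x} {y} h = ≤-resp-≈ (⁻¹-involutive x) (⁻¹-involutive y) (neg-mono-≤ h)

  0≤1 : 0# ≤ 1#
  0≤1 with total 0# 1#
  ... | inj₁ 0≤1 = 0≤1
  ... | inj₂ 1≤0 = ≤-respʳ-≈ (trans (-1*x≈-x (- 1#)) (⁻¹-involutive 1#))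
                     (*-nonNeg (x≤0⇒0≤-x 1≤0) (x≤0⇒0≤-x 1≤0))

  -1≤0 : - 1# ≤ 0#
  -1≤0 = ≤-respˡ-≈ (+-identityˡ _) (x≤y⇒x-y≤0 0≤1)

  inverse-nonNeg : ∀ {x y} → 0# ≤ x → x * y ≈ 1# → 0# ≤ y
  inverse-nonNeg {x} {y} 0≤x xy≈1 with total 0# y
  ... | inj₁ 0≤y = 0≤y
  ... | inj₂ y≤0 = contradiction (antisym 0≤1 (0≤-x⇒x≤0 0≤-1)) 0≉1
    where
    0≤-1 : 0# ≤ - 1#
    0≤-1 = ≤-respʳ-≈ (trans (sym (-‿distribʳ-* x y)) (-‿cong xy≈1))
             (*-nonNeg 0≤x (x≤0⇒0≤-x y≤0))

  *-monoˡ-≤ : ∀ {x y z} → 0# ≤ x → y ≤ z → x * y ≤ x * z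
  *-monoˡ-≤ {x} {y} {z} 0≤x y≤z = begin
    x * y                ≈⟨ +-identityˡ _ ⟨
    0# + x * y           ≤⟨ +-monoˡ-≤ (x * y) (*-nonNeg 0≤x (x≤y⇒0≤y-x y≤z)) ⟩
    x * (z - y) + x * y  ≈⟨ distribˡ x (z - y) y ⟨
    x * (z - y + y)      ≈⟨ *-congˡ (x-y+y≈x z y) ⟩
    x * z                ∎

  -- The distribution of one random bit, where `hi` is the probability that it is set.
  record Weights : Set (c ⊔ ℓ₁ ⊔ ℓ₂) where
    field
      lo hi     : Carrier
      lo-nonNeg : 0# ≤ lo
      hi-nonNeg : 0# ≤ hi
      lo+hi     : lo + hi ≈ 1#

    mean : Carrier → Carrier → Carrier
    mean x y = lo * x + hi * y

    mean-cong : ∀ {x x′ y y′} → x ≈ x′ → y ≈ y′ → mean x y ≈ mean x′ y′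
    mean-cong x≈x′ y≈y′ = +-cong (*-congˡ x≈x′) (*-congˡ y≈y′)

    mean-idem : ∀ x → mean x x ≈ x
    mean-idem x = trans (sym (distribʳ x lo hi)) (trans (*-congʳ lo+hi) (*-identityˡ x))

    mean-hi≈1 : hi ≈ 1# → ∀ x y → mean x y ≈ y
    mean-hi≈1 hi≈1 x y = begin-equality
      lo * x + hi * y ≈⟨ +-cong (*-congʳ lo≈0) (*-congʳ hi≈1) ⟩
      0# * x + 1# * y ≈⟨ +-cong (zeroˡ x) (*-identityˡ y) ⟩
      0# + y          ≈⟨ +-identityˡ y ⟩
      y               ∎
      where
      lo≈0 : lo ≈ 0#
      lo≈0 = +-cancelʳ-≈ hi (trans lo+hi (trans (sym hi≈1) (sym (+-identityˡ hi))))

  mean-comm : ∀ s t x y u v → let open Weights in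
    mean s (mean t x y) (mean t u v) ≈ mean t (mean s x u) (mean s y v)
  mean-comm s t = solve 8
    (λ l h l′ h′ x y u v →
      l :* (l′ :* x :+ h′ :* y) :+ h :* (l′ :* u :+ h′ :* v) :=
      l′ :* (l :* x :+ h :* u) :+ h′ :* (l :* y :+ h :* v))
    refl (lo s) (hi s) (lo t) (hi t)
    where open Weights

  top : Weights
  top = record
    { lo = 0# ; hi = 1# ; lo-nonNeg = ≤-refl ; hi-nonNeg = 0≤1 ; lo+hi = +-identityˡ 1# }

  -- The order of `l`, `t`, `u` enters only the conclusion, so that every coordinate, in range or
  -- not, can be given weights. The last clause is a tie-break: even if all three coincide, `hi` is
  -- 1, and a coordinate at its upper bound has a certain bit.
  interpolate : ∀ l t u → Σ[ s ∈ Weights ] let open Weights s in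
    (l ≤ t → t ≤ u → mean l u ≈ t) × (t ≈ u → hi ≈ 1#)
  interpolate l t u with t ≟ u | l ≤? t | t ≤? u
  ... | no t≉u | yes l≤t | yes t≤u = s , (λ _ _ → mean-t) , λ t≈u → contradiction t≈u t≉u
    where
    -- The weights are `(u - t) / (u - l)` and `(t - l) / (u - l)`; `a + b` is `u - l`, nonzero
    -- because `l ≤ t ≤ u` and `t ≉ u`.
    a = t - l
    b = u - t
    0≤a = x≤y⇒0≤y-x l≤t
    0≤b = x≤y⇒0≤y-x t≤u

    a+b≉0 : ¬ a + b ≈ 0#
    a+b≉0 a+b≈0 = t≉u (antisym t≤u (x-y≤0⇒x≤y (begin
      b      ≈⟨ +-identityˡ b ⟨
      0# + b ≤⟨ +-monoˡ-≤ b 0≤a ⟩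
      a + b  ≈⟨ a+b≈0 ⟩
      0#     ∎)))

    d = proj₁ (inverse (a + b) a+b≉0)
    [a+b]d≈1 = proj₂ (inverse (a + b) a+b≉0)
    0≤d = inverse-nonNeg (≤-respˡ-≈ (+-identityˡ 0#) (+-mono-≤ 0≤a 0≤b)) [a+b]d≈1

    s : Weights
    s = record
      { lo = b * d
      ; hi = a * d
      ; lo-nonNeg = *-nonNeg 0≤b 0≤d
      ; hi-nonNeg = *-nonNeg 0≤a 0≤d
      ; lo+hi = trans (+-comm _ _) (trans (sym (distribʳ d a b)) [a+b]d≈1)
      }

    mean-t : b * d * l + a * d * u ≈ t
    mean-t = begin-equality
      b * d * l + a * d * u
        ≈⟨ +-congˡ (*-congˡ (trans (sym (x-y+y≈x u t)) (+-comm b t))) ⟩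
      b * d * l + a * d * (t + b)
        ≈⟨ solve 5 (λ a b d l t → b :* d :* l :+ a :* d :* (t :+ b) :=
             b :* d :* (a :+ l) :+ a :* d :* t) refl a b d l t ⟩
      b * d * (a + l) + a * d * t
        ≈⟨ +-congʳ (*-congˡ (x-y+y≈x t l)) ⟩
      b * d * t + a * d * t
        ≈⟨ Weights.mean-idem s t ⟩
      t ∎
  ... | yes t≈u | _      | _       =
    top , (λ _ _ → trans (Weights.mean-hi≈1 top refl l u) (sym t≈u)) , const refl
  -- Bounds out of order leave nothing to interpolate; `top` is a default value.
  ... | no _    | no l≰t | _       = top , (λ l≤t → contradiction l≤t l≰t) , const refl
  ... | no _    | yes _  | no t≰u  = top , (λ _ t≤u → contradiction t≤u t≰u) , const refl

-- Linear forms, polyhedra, convex hulls and expectations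

module Convexity {c ℓ₁ ℓ₂} (K : OrderedField c ℓ₁ ℓ₂) where

  open OrderedField K hiding (zero)
  open OrderedFieldProperties K
  open RingProperties ring using (-1*x≈-x)
  open SumProperties semiring
    using (sum; sum-cong-≋; *-distribˡ-sum; *-distribʳ-sum)
  open SemiringSolver commutativeSemiring using (solve; _:=_; _:+_; _:*_)
  open PosetReasoning poset

  private
    variable
      X Y : Set
      ℓ ℓ′ : Level

  -- Zero, negatives and finite sums follow from these fields; `isLinearForm` and `linear` translate
  -- to and from the module homomorphisms of the statement.
  record Linear (a : Space K X → Carrier) : Set (c ⊔ ℓ₁) where
    field
      cong   : ∀ {u v} → _≋_ K u v → a u ≈ a v
      homo-+ : ∀ u v → a (λ e → u e + v e) ≈ a u + a v
      homo-* : ∀ r v → a (λ e → r * v e) ≈ r * a v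

    homo-0 : a (λ _ → 0#) ≈ 0#
    homo-0 = begin-equality
      a (λ _ → 0#)      ≈⟨ cong (λ _ → zeroˡ 0#) ⟨
      a (λ _ → 0# * 0#) ≈⟨ homo-* 0# _ ⟩
      0# * a (λ _ → 0#) ≈⟨ zeroˡ _ ⟩
      0#                ∎

    homo-neg : ∀ v → a (λ e → - v e) ≈ - a v
    homo-neg v = begin-equality
      a (λ e → - v e)      ≈⟨ cong (λ e → -1*x≈-x (v e)) ⟨
      a (λ e → - 1# * v e) ≈⟨ homo-* (- 1#) v ⟩
      - 1# * a v           ≈⟨ -1*x≈-x (a v) ⟩
      - a v                ∎

    homo-sum : ∀ {n} (μ : Fin n → Carrier) (s : Fin n → Space K X) →
      a (λ e → sum (λ k → μ k * s k e)) ≈ sum (λ k → μ k * a (s k))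
    homo-sum {zero}  μ s = homo-0
    homo-sum {suc n} μ s = begin-equality
      a (λ e → sum (λ k → μ k * s k e))
        ≈⟨ homo-+ _ _ ⟩
      a (λ e → μ zero * s zero e) + a (λ e → sum (λ k → μ (suc k) * s (suc k) e))
        ≈⟨ +-cong (homo-* (μ zero) (s zero)) (homo-sum (μ ∘ suc) (s ∘ suc)) ⟩
      sum (λ k → μ k * a (s k)) ∎

  coordinate : ∀ (e : X) → Linear (λ v → v e)
  coordinate e = record { cong = _$ e ; homo-+ = λ _ _ → refl ; homo-* = λ _ _ → refl }

  linear-0 : Linear {X} (λ _ → 0#)
  linear-0 = record
    { cong = λ _ → refl
    ; homo-+ = λ _ _ → sym (+-identityˡ 0#)
    ; homo-* = λ r _ → sym (zeroʳ r)
    }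

  private
    variable
      a b : Space K X → Carrier

  linear-+ : Linear a → Linear b → Linear (λ v → a v + b v)
  linear-+ {a = a} {b} la lb = record
    { cong = λ u≋v → +-cong (La.cong u≋v) (Lb.cong u≋v)
    ; homo-+ = λ u v → trans (+-cong (La.homo-+ u v) (Lb.homo-+ u v))
        (solve 4 (λ x y u v → (x :+ y) :+ (u :+ v) := (x :+ u) :+ (y :+ v)) refl
           (a u) (a v) (b u) (b v))
    ; homo-* = λ r v → trans (+-cong (La.homo-* r v) (Lb.homo-* r v)) (sym (distribˡ r _ _))
    }
    where
    module La = Linear la
    module Lb = Linear lb

  linear-* : ∀ r → Linear a → Linear (λ v → r * a v)
  linear-* {a = a} r la = record
    { cong = λ u≋v → *-congˡ (La.cong u≋v)
    ; homo-+ = λ u v → trans (*-congˡ (La.homo-+ u v)) (distribˡ r _ _)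
    ; homo-* = λ r′ v → trans (*-congˡ (La.homo-* r′ v))
        (solve 3 (λ x y z → x :* (y :* z) := y :* (x :* z)) refl r r′ (a v))
    }
    where module La = Linear la

  linear-resp : (∀ v → b v ≈ a v) → Linear a → Linear b
  linear-resp b≈a la = record
    { cong = λ u≋v → trans (b≈a _) (trans (La.cong u≋v) (sym (b≈a _)))
    ; homo-+ = λ u v → trans (b≈a _) (trans (La.homo-+ u v) (sym (+-cong (b≈a u) (b≈a v))))
    ; homo-* = λ r v → trans (b≈a _) (trans (La.homo-* r v) (sym (*-congˡ (b≈a v))))
    }
    where module La = Linear la

  linear-neg : Linear a → Linear (λ v → - a v)
  linear-neg la = linear-resp (λ v → sym (-1*x≈-x _)) (linear-* (- 1#) la)

  linear-∘ : {f : Space K X → Space K Y} {a : Space K Y → Carrier} → Linear a →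
    (∀ e → Linear (λ v → f v e)) → Linear (λ v → a (f v))
  linear-∘ la lf = record
    { cong = λ u≋v → La.cong λ e → Linear.cong (lf e) u≋v
    ; homo-+ = λ u v → trans (La.cong λ e → Linear.homo-+ (lf e) u v) (La.homo-+ _ _)
    ; homo-* = λ r v → trans (La.cong λ e → Linear.homo-* (lf e) r v) (La.homo-* r _)
    }
    where module La = Linear la

  isLinear : {f : Space K X → Space K Y} → (∀ e → Linear (λ v → f v e)) → IsLinear K f
  isLinear lf = record
    { +ᴹ-isGroupHomomorphism = record
      { isMonoidHomomorphism = record
        { isMagmaHomomorphism = record
          { isRelHomomorphism = record { cong = λ u≋v e → Linear.cong (lf e) u≋v }
          ; homo = λ u v e → Linear.homo-+ (lf e) u v
          }
        ; ε-homo = λ e → Linear.homo-0 (lf e)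
        }
      ; ⁻¹-homo = λ v e → Linear.homo-neg (lf e) v
      }
    ; *ₗ-homo = λ r v e → Linear.homo-* (lf e) r v
    }

  isLinearForm : Linear a → IsLinearForm K a
  isLinearForm la = record
    { +ᴹ-isGroupHomomorphism = record
      { isMonoidHomomorphism = record
        { isMagmaHomomorphism = record
          { isRelHomomorphism = record { cong = La.cong }
          ; homo = La.homo-+
          }
        ; ε-homo = La.homo-0
        }
      ; ⁻¹-homo = La.homo-neg
      }
    ; *ₗ-homo = La.homo-*
    }
    where module La = Linear la

  linear : IsLinearForm K a → Linear a
  linear ha = record { cong = H.⟦⟧-cong ; homo-+ = H.+ᴹ-homo ; homo-* = H.*ₗ-homo }
    where
    module H = LeftModuleMorphisms.IsLeftModuleHomomorphism
      {M₁ = space K _} {M₂ = TensorUnit.rawLeftModule {R = rawRing}} ha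

  -- Polyhedra

  private
    variable
      P Q : Pred (Space K X) ℓ

  polyhedron-resp : (∀ v → v ∈ P ⇔ v ∈ Q) → IsPolyhedron K P → IsPolyhedron K Q
  polyhedron-resp P⇔Q (m , a , b , la , P⇔) =
    m , a , b , la , λ v → mk⇔ (to (P⇔ v) ∘ from (P⇔Q v)) (to (P⇔Q v) ∘ from (P⇔ v))
    where open Equivalence

  polyhedron-≤const : Linear a → ∀ r → IsPolyhedron K (λ v → a v ≤ r)
  polyhedron-≤const {a = a} la r =
    1 , const a , const r , const (isLinearForm la) , λ v → mk⇔ const (_$ zero)

  polyhedron-≤ : Linear a → Linear b → IsPolyhedron K (λ v → a v ≤ b v)
  polyhedron-≤ la lb =
    polyhedron-resp (λ v → mk⇔ x-y≤0⇒x≤y x≤y⇒x-y≤0)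
      (polyhedron-≤const (linear-+ la (linear-neg lb)) 0#)

  polyhedron-const≤ : Linear a → ∀ r → IsPolyhedron K (λ v → r ≤ a v)
  polyhedron-const≤ la r =
    polyhedron-resp (λ v → mk⇔ neg-cancel-≤ neg-mono-≤) (polyhedron-≤const (linear-neg la) (- r))

  polyhedron-⊤ : IsPolyhedron K {X} (λ _ → 0# ≤ 0#)
  polyhedron-⊤ = polyhedron-≤const linear-0 0#

  polyhedron-∩ : IsPolyhedron K P → IsPolyhedron K Q → IsPolyhedron K (P ∩ Q)
  polyhedron-∩ (m , a , b , la , P⇔) (n , a′ , b′ , la′ , Q⇔) =
    m ℕ.+ n , [ a , a′ ]′ ∘ splitAt m , [ b , b′ ]′ ∘ splitAt m , (λ k → form (splitAt m k)) ,
    λ v → mk⇔ (λ (v∈P , v∈Q) k → bound (to (P⇔ v) v∈P) (to (Q⇔ v) v∈Q) (splitAt m k))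
              (λ h → from (P⇔ v) (λ k → ≡.subst (λ x → [ a , a′ ]′ x v ≤ [ b , b′ ]′ x)
                                      (splitAt-↑ˡ m k n) (h (k Fin.↑ˡ n))) ,
                     from (Q⇔ v) (λ k → ≡.subst (λ x → [ a , a′ ]′ x v ≤ [ b , b′ ]′ x)
                                      (splitAt-↑ʳ m n k) (h (m Fin.↑ʳ k))))
    where
    open Equivalence
    form : ∀ x → IsLinearForm K ([ a , a′ ]′ x)
    form (inj₁ k) = la k
    form (inj₂ k) = la′ k
    bound : ∀ {v} → (∀ k → a k v ≤ b k) → (∀ k → a′ k v ≤ b′ k) →
            ∀ x → [ a , a′ ]′ x v ≤ [ b , b′ ]′ x
    bound h h′ (inj₁ k) = h k
    bound h h′ (inj₂ k) = h′ k

  polyhedron-∀< : ∀ n {P : ℕ → Pred (Space K X) ℓ} → (∀ i → IsPolyhedron K (P i)) →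
    IsPolyhedron K (λ v → ∀ {i} → i ℕ.< n → P i v)
  polyhedron-∀< zero hP = polyhedron-resp (λ v → mk⇔ (λ _ ()) (λ _ → ≤-refl)) polyhedron-⊤
  polyhedron-∀< (suc n) {P} hP =
    polyhedron-resp (λ v → mk⇔ cons (λ h → h ℕ.z<s , h ∘ ℕ.s<s))
      (polyhedron-∩ (hP 0) (polyhedron-∀< n (hP ∘ suc)))
    where
    cons : ∀ {v} → P 0 v × (∀ {i} → i ℕ.< n → P (suc i) v) → ∀ {i} → i ℕ.< suc n → P i v
    cons (h , hs) {zero}  _            = h
    cons (h , hs) {suc i} (ℕ.s≤s i<n) = hs i<n

  polyhedron-convex : IsPolyhedron K P → ∀ {n} {μ : Fin n → Carrier} {s : Fin n → Space K X} →
    (∀ k → 0# ≤ μ k) → sum μ ≈ 1# → (∀ k → s k ∈ P) → (λ e → sum (λ k → μ k * s k e)) ∈ P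
  polyhedron-convex (m , a , b , la , P⇔) {μ = μ} {s} μ≥0 μ≈1 s∈P = from (P⇔ _) λ l → begin
    a l (λ e → sum (λ k → μ k * s k e)) ≈⟨ Linear.homo-sum (linear (la l)) μ s ⟩
    sum (λ k → μ k * a l (s k))         ≤⟨ sum-mono (λ k → *-monoˡ-≤ (μ≥0 k) (to (P⇔ (s k)) (s∈P k) l)) ⟩
    sum (λ k → μ k * b l)               ≈⟨ *-distribʳ-sum (b l) μ ⟨
    sum μ * b l                         ≈⟨ *-congʳ μ≈1 ⟩
    1# * b l                            ≈⟨ *-identityˡ (b l) ⟩
    b l                                 ∎
    where
    open Equivalence
    sum-mono : ∀ {n} {f g : Fin n → Carrier} → (∀ k → f k ≤ g k) → sum f ≤ sum g
    sum-mono {zero}  h = ≤-refl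
    sum-mono {suc n} h = +-mono-≤ (h zero) (sum-mono (h ∘ suc))

  -- Convex hulls

  private
    variable
      S : Pred (Space K X) ℓ

  hull-resp : {x y : Space K X} → _≋_ K x y → x ∈ ConvexHull K S → y ∈ ConvexHull K S
  hull-resp x≋y (n , μ , s , μ≥0 , μ≈1 , s∈S , x≋) =
    n , μ , s , μ≥0 , μ≈1 , s∈S , λ e → trans (sym (x≋y e)) (x≋ e)

  hull-inj : {x : Space K X} → x ∈ S → x ∈ ConvexHull K S
  hull-inj {x = x} x∈S = 1 , const 1# , const x , const 0≤1 , +-identityʳ 1# , const x∈S ,
    λ e → sym (trans (+-identityʳ _) (*-identityˡ (x e)))

  sum-splitAt : ∀ m {n} (f : Fin m ⊎ Fin n → Carrier) →
    sum (f ∘ splitAt m) ≈ sum (f ∘ inj₁) + sum (f ∘ inj₂)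
  sum-splitAt zero    f = sym (+-identityˡ _)
  sum-splitAt (suc m) f =
    trans (+-congˡ (sum-splitAt m (f ∘ Sum.map₁ suc))) (sym (+-assoc _ _ _))

  -- List both combinations one after the other, with coefficients scaled by `lo` and `hi`.
  hull-mean : (w : Weights) {x y : Space K X} → x ∈ ConvexHull K S → y ∈ ConvexHull K S →
    (λ e → Weights.mean w (x e) (y e)) ∈ ConvexHull K S
  hull-mean {S = S} w {x} {y} (m , μ , s , μ≥0 , μ≈1 , s∈S , x≋) (n , ν , t , ν≥0 , ν≈1 , t∈S , y≋) =
    m ℕ.+ n , ρ ∘ splitAt m , r ∘ splitAt m , (λ k → ρ≥0 (splitAt m k)) , ρ≈1 ,
    (λ k → r∈S (splitAt m k)) , λ e → begin-equality
      lo * x e + hi * y e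
        ≈⟨ mean-cong (x≋ e) (y≋ e) ⟩
      lo * sum (λ k → μ k * s k e) + hi * sum (λ k → ν k * t k e)
        ≈⟨ +-cong (scale lo μ s e) (scale hi ν t e) ⟩
      sum (λ k → lo * μ k * s k e) + sum (λ k → hi * ν k * t k e)
        ≈⟨ sum-splitAt m (λ k → ρ k * r k e) ⟨
      sum (λ k → ρ (splitAt m k) * r (splitAt m k) e) ∎
    where
    open Weights w
    ρ : Fin m ⊎ Fin n → Carrier
    ρ = [ (λ k → lo * μ k) , (λ k → hi * ν k) ]′
    r : Fin m ⊎ Fin n → Space K _
    r = [ s , t ]′
    ρ≥0 : ∀ k → 0# ≤ ρ k
    ρ≥0 (inj₁ k) = *-nonNeg lo-nonNeg (μ≥0 k)
    ρ≥0 (inj₂ k) = *-nonNeg hi-nonNeg (ν≥0 k)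
    r∈S : ∀ k → r k ∈ S
    r∈S (inj₁ k) = s∈S k
    r∈S (inj₂ k) = t∈S k
    ρ≈1 : sum (ρ ∘ splitAt m) ≈ 1#
    ρ≈1 = begin-equality
      sum (ρ ∘ splitAt m)                          ≈⟨ sum-splitAt m ρ ⟩
      sum (λ k → lo * μ k) + sum (λ k → hi * ν k)  ≈⟨ +-cong (*-distribˡ-sum lo μ) (*-distribˡ-sum hi ν) ⟨
      lo * sum μ + hi * sum ν                      ≈⟨ mean-cong μ≈1 ν≈1 ⟩
      mean 1# 1#                                   ≈⟨ mean-idem 1# ⟩
      1#                                           ∎
    scale : ∀ {n} r (μ : Fin n → Carrier) (s : Fin n → Space K _) e →
      r * sum (λ k → μ k * s k e) ≈ sum (λ k → r * μ k * s k e)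
    scale r μ s e = trans (*-distribˡ-sum r (λ k → μ k * s k e))
      (sum-cong-≋ λ k → sym (*-assoc r (μ k) (s k e)))

  -- Lifting the generators suffices: `P` is convex and `π` linear, so the same coefficients combine
  -- the lifts.
  extendedFormulation : {P : Pred (Space K X) ℓ} {S : Pred (Space K Y) ℓ′} → IsPolytope K P →
    (π : Space K X → Space K Y) → (∀ e → Linear (λ v → π v e)) →
    (∀ {s} → s ∈ S → ∃[ v ] v ∈ P × _≋_ K (π v) s) →
    (∀ {v} → v ∈ P → π v ∈ ConvexHull K S) →
    IsExtendedFormulation K P (ConvexHull K S)
  extendedFormulation {P = P} {S} polytope π lπ lift sound =
    polytope , π , isLinear lπ , λ x →
      mk⇔ (to x) (λ (v , v∈P , πv≋x) → hull-resp {S = S} πv≋x (sound v∈P))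
    where
    to : ∀ x → x ∈ ConvexHull K S → ∃[ v ] v ∈ P × _≋_ K (π v) x
    to x (n , μ , s , μ≥0 , μ≈1 , s∈S , x≋) =
      (λ e → sum (λ k → μ k * v k e)) ,
      polyhedron-convex (proj₁ polytope) μ≥0 μ≈1 (λ k → proj₁ (proj₂ (lift (s∈S k)))) ,
      λ e → begin-equality
        π (λ e → sum (λ k → μ k * v k e)) e ≈⟨ Linear.homo-sum (lπ e) μ v ⟩
        sum (λ k → μ k * π (v k) e)         ≈⟨ sum-cong-≋ (λ k → *-congˡ (proj₂ (proj₂ (lift (s∈S k))) e)) ⟩
        sum (λ k → μ k * s k e)             ≈⟨ x≋ e ⟨
        x e                                 ∎
      where v = λ k → proj₁ (lift (s∈S k))

  indicator : Bool → Carrier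
  indicator b = if b then 1# else 0#

  -- The expectation of a function of independent random bits, where bit x is
  -- set with probability hi (w x) for x in a list, and always set otherwise.

  module Expectation {X : Set} (_≟ˣ_ : DecidableEquality X) (w : X → Weights) where

    open Weights

    _[_≔_] : (X → Bool) → X → Bool → (X → Bool)
    (b [ x ≔ r ]) y = if does (y ≟ˣ x) then r else b y

    ≔-≡ : ∀ b x r → (b [ x ≔ r ]) x ≡ r
    ≔-≡ b x r with x ≟ˣ x
    ... | yes _  = ≡.refl
    ... | no x≢x = contradiction ≡.refl x≢x

    ≔-≢ : ∀ b x r {y} → y ≢ x → (b [ x ≔ r ]) y ≡ b y
    ≔-≢ b x r {y} y≢x with y ≟ˣ x
    ... | yes y≡x = contradiction y≡x y≢x
    ... | no _    = ≡.refl

    E : List X → ((X → Bool) → Carrier) → Carrier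
    E []       f = f (const true)
    E (x ∷ xs) f = mean (w x) (E xs λ b → f (b [ x ≔ false ])) (E xs λ b → f (b [ x ≔ true ]))

    E-linear : ∀ xs → Linear (E xs)
    E-linear []       = coordinate (const true)
    E-linear (x ∷ xs) = linear-+
      (linear-* _ (linear-∘ (E-linear xs) (λ b → coordinate (b [ x ≔ false ]))))
      (linear-* _ (linear-∘ (E-linear xs) (λ b → coordinate (b [ x ≔ true ]))))

    E-const : ∀ xs r → E xs (const r) ≈ r
    E-const []       r = refl
    E-const (x ∷ xs) r = trans (mean-cong (w x) (E-const xs r) (E-const xs r)) (mean-idem (w x) r)

    -- `E` starts from all bits set and changes only listed ones, so `h` is asked only about
    -- outcomes whose unlisted bits are set.
    E-hull : ∀ xs (s : (X → Bool) → Space K Y) {S : Pred (Space K Y) ℓ} →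
      (∀ b → (∀ x → x ∉ xs → b x ≡ true) → s b ∈ ConvexHull K S) →
      (λ e → E xs (λ b → s b e)) ∈ ConvexHull K S
    E-hull []       s h = h (const true) (λ _ _ → ≡.refl)
    E-hull (x ∷ xs) s {S} h = hull-mean {S = S} (w x) (branch false) (branch true)
      where
      branch : ∀ r → (λ e → E xs (λ b → s (b [ x ≔ r ]) e)) ∈ ConvexHull K S
      branch r = E-hull xs (λ b → s (b [ x ≔ r ])) {S} λ b hb → h (b [ x ≔ r ]) λ y y∉ →
        ≡.trans (≔-≢ b x r (y∉ ∘ here)) (hb y (y∉ ∘ there))

    Ignores : X → ((X → Bool) → Bool) → Set
    Ignores x f = ∀ {b b′} → (∀ {y} → y ≢ x → b y ≡ b′ y) → f b ≡ f b′

    private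
      choose : X → (g f : (X → Bool) → Bool) → (X → Bool) → Carrier
      choose x g f b = indicator (if b x then f b else g b)

      E-cong : ∀ xs {f g : (X → Bool) → Bool} → (∀ b → f b ≡ g b) →
               E xs (indicator ∘ f) ≈ E xs (indicator ∘ g)
      E-cong xs f≡g = Linear.cong (E-linear xs) λ b → reflexive (≡.cong indicator (f≡g b))

      E-ignore : ∀ x xs {f} r → Ignores x f →
        E xs (λ b → indicator (f (b [ x ≔ r ]))) ≈ E (x ∷ xs) (indicator ∘ f)
      E-ignore x xs {f} r f-ign =
        trans (sym (mean-idem (w x) _)) (mean-cong (w x) (either false) (either true))
        where
        either : ∀ r′ → E xs (λ b → indicator (f (b [ x ≔ r ]))) ≈
                        E xs (λ b → indicator (f (b [ x ≔ r′ ])))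
        either r′ = E-cong xs λ b → f-ign λ y≢x → ≡.trans (≔-≢ b x r y≢x) (≡.sym (≔-≢ b x r′ y≢x))

    -- Independence: bit `x` decides between two events that do not read it, so averaging over it
    -- averages their probabilities. The bits before it in the list are moved inside by `mean-comm`.
    -- An unlisted bit is always set, which agrees with `hi (w x) ≈ 1#`.
    E-choose : ∀ xs {x g f} → x ∈ˡ xs ⊎ hi (w x) ≈ 1# → Ignores x g → Ignores x f →
      E xs (λ b → indicator (if b x then f b else g b)) ≈
      mean (w x) (E xs (indicator ∘ g)) (E xs (indicator ∘ f))
    E-choose []       {x} (inj₂ hi≈1) _ _ = sym (mean-hi≈1 (w x) hi≈1 _ _)
    E-choose (y ∷ xs) {x} {g} {f} x∈ g-ign f-ign = by-cases (x ≟ˣ y)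
      where
      shift : ∀ {f} r → Ignores x f → Ignores x (λ b → f (b [ y ≔ r ]))
      shift r f-ign {b} {b′} b≗b′ = f-ign λ {z} z≢x → agree z z≢x
        where
        agree : ∀ z → z ≢ x → (b [ y ≔ r ]) z ≡ (b′ [ y ≔ r ]) z
        agree z z≢x with z ≟ˣ y
        ... | yes _ = ≡.refl
        ... | no _  = b≗b′ z≢x

      by-cases : Dec (x ≡ y) → E (y ∷ xs) (choose x g f) ≈
        mean (w x) (E (y ∷ xs) (indicator ∘ g)) (E (y ∷ xs) (indicator ∘ f))
      by-cases (yes ≡.refl) = mean-cong (w x)
        (trans (E-cong xs λ b →
                 ≡.cong (if_then f (b [ x ≔ false ]) else g (b [ x ≔ false ])) (≔-≡ b x false))
               (E-ignore x xs false g-ign))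
        (trans (E-cong xs λ b →
                 ≡.cong (if_then f (b [ x ≔ true ]) else g (b [ x ≔ true ])) (≔-≡ b x true))
               (E-ignore x xs true f-ign))
      by-cases (no x≢y) =
        trans (mean-cong (w y) (branch false) (branch true)) (mean-comm (w y) (w x) _ _ _ _)
        where
        x∈′ : x ∈ˡ y ∷ xs ⊎ hi (w x) ≈ 1# → x ∈ˡ xs ⊎ hi (w x) ≈ 1#
        x∈′ (inj₁ (here x≡y))   = contradiction x≡y x≢y
        x∈′ (inj₁ (there x∈xs)) = inj₁ x∈xs
        x∈′ (inj₂ hi≈1)         = inj₂ hi≈1

        branch : ∀ r → E xs (λ b → choose x g f (b [ y ≔ r ])) ≈
          mean (w x) (E xs (λ b → indicator (g (b [ y ≔ r ]))))
                     (E xs (λ b → indicator (f (b [ y ≔ r ]))))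
        branch r = trans
          (E-cong xs λ b → ≡.cong (if_then f (b [ y ≔ r ]) else g (b [ y ≔ r ])) (≔-≢ b y r x≢y))
          (E-choose xs (x∈′ x∈) (shift r g-ign) (shift r f-ign))

open Patterns

-- Feasible points and patterns

module Orbitopes {c ℓ₁ ℓ₂} (K : OrderedField c ℓ₁ ℓ₂) (p q : ℕ) where

  open OrderedField K hiding (zero)
  open OrderedFieldProperties K
  open Convexity K
  open GroupProperties +-group using () renaming (ε⁻¹≈ε to -0≈0)
  open PosetReasoning poset

  -- The compact system on the full rectangle, with boundary values for column 0 and row 0 of `W`
  -- and column `suc q` of `Z`. The bound 1 then comes from `W-upper` in column 1, and nonnegativity
  -- from `W-lower`. Arbitrary `W` and `Z` are allowed so that the raised point is covered too.
  record Feasible (W Z : ℕ → ℕ → Carrier) : Set (ℓ₁ ⊔ ℓ₂) where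
    field
      W-left  : ∀ i → W i 0 ≈ 1#
      W-first : ∀ j → W 0 (suc j) ≈ 0#
      Z-last  : ∀ i → Z (suc i) (suc q) ≈ 0#
      W-lower : ∀ {i j} → i ℕ.< p → j ℕ.< q → W i (suc j) ≤ W (suc i) (suc j)
      W-upper : ∀ {i j} → i ℕ.< p → j ℕ.< q → W (suc i) (suc j) ≤ W i j
      Z-lower : ∀ {i j} → i ℕ.< p → j ℕ.< q →
        Z (suc i) (suc (suc j)) + W (suc i) (suc j) ≤ Z (suc i) (suc j) + W i (suc j)
      Z-upper : ∀ {i j} → i ℕ.< p → j ℕ.< q → Z (suc i) (suc j) ≤ W (suc i) (suc j)

    W-nonNeg : ∀ i j → i ℕ.≤ p → j ℕ.≤ q → 0# ≤ W i j
    W-nonNeg i       zero    _   _   = ≤-respʳ-≈ (sym (W-left i)) 0≤1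
    W-nonNeg zero    (suc j) _   _   = ≤-reflexive (sym (W-first j))
    W-nonNeg (suc i) (suc j) i<p j<q =
      ≤-trans (W-nonNeg i (suc j) (ℕ.<⇒≤ i<p) j<q) (W-lower i<p j<q)

    W-≤1 : ∀ i j → i ℕ.≤ p → j ℕ.≤ q → W i j ≤ 1#
    W-≤1 i       zero    _   _   = ≤-reflexive (W-left i)
    W-≤1 zero    (suc j) _   _   = ≤-respˡ-≈ (sym (W-first j)) 0≤1
    W-≤1 (suc i) (suc j) i<p j<q = ≤-trans (W-upper i<p j<q) (W-≤1 i j (ℕ.<⇒≤ i<p) (ℕ.<⇒≤ j<q))

    -- `Z-lower` and `W-lower` together make each row of `Z` decrease to the value 0 in column
    -- `suc q`.
    Z-nonNeg : ∀ {i} k j → i ℕ.< p → k ℕ.+ j ≡ q → 0# ≤ Z (suc i) (suc j)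
    Z-nonNeg {i} zero    j i<p ≡.refl = ≤-reflexive (sym (Z-last i))
    Z-nonNeg {i} (suc k) j i<p ≡.refl =
      ≤-trans (Z-nonNeg k (suc j) i<p (ℕ.+-suc k j)) (+-cancelʳ-≤ (W (suc i) (suc j)) (begin
        Z (suc i) (suc (suc j)) + W (suc i) (suc j) ≤⟨ Z-lower i<p j<q ⟩
        Z (suc i) (suc j) + W i (suc j)             ≤⟨ +-monoʳ-≤ _ (W-lower i<p j<q) ⟩
        Z (suc i) (suc j) + W (suc i) (suc j)       ∎))
      where
      j<q : j ℕ.< q
      j<q = ℕ.s≤s (ℕ.m≤n+m j k)

  indicator-mono : ∀ {a b} → a ⊑ b → indicator a ≤ indicator b
  indicator-mono {true}  {b} a⊑b rewrite a⊑b ≡.refl = ≤-refl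
  indicator-mono {false} {true}  _ = 0≤1
  indicator-mono {false} {false} _ = ≤-refl

  indicator-∧-not : ∀ a b → b ⊑ a → indicator (a ∧ not b) ≈ indicator a - indicator b
  indicator-∧-not true  true  _ = sym (-‿inverseʳ 1#)
  indicator-∧-not true  false _ = sym (trans (+-congˡ -0≈0) (+-identityʳ 1#))
  indicator-∧-not false true  b⊑a = contradiction (b⊑a ≡.refl) λ ()
  indicator-∧-not false false _ = sym (-‿inverseʳ 0#)

  -- `b ⊑ a` turns the difference of `a` and `b` into `a ∧ not b`, and `t ⊑ b` keeps this apart from
  -- `t`, so the disjunction is a sum.
  indicator-lower : ∀ {t a b} → b ⊑ a → t ⊑ b →
    indicator (t ∨ (a ∧ not b)) + indicator b ≈ indicator t + indicator a
  indicator-lower {t} {a} {true} b⊑a _ rewrite b⊑a ≡.refl with t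
  ... | true  = refl
  ... | false = refl
  indicator-lower {true}  {_}     {false} _ t⊑b = contradiction (t⊑b ≡.refl) λ ()
  indicator-lower {false} {true}  {false} _ _ = +-comm 1# 0#
  indicator-lower {false} {false} {false} _ _ = refl

  pattern-feasible : ∀ {W Z} → IsPattern q W Z →
    Feasible (λ i j → indicator (W i j)) (λ i j → indicator (Z i j))
  pattern-feasible {W} {Z} pat = record
    { W-left  = λ i → reflexive (≡.cong indicator (W-left i))
    ; W-first = λ j → reflexive (≡.cong indicator (W-first j))
    ; Z-last  = λ i → reflexive (≡.cong indicator (Z-last i))
    ; W-lower = λ _ _ → indicator-mono W-keep
    ; W-upper = λ _ _ → indicator-mono W-open
    ; Z-lower = λ _ → Z-lower _ _
    ; Z-upper = λ _ _ → indicator-mono Z-used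
    }
    where
    open IsPattern pat
    Z-lower : ∀ i j → j ℕ.< q →
      indicator (Z (suc i) (suc (suc j))) + indicator (W (suc i) (suc j)) ≤
      indicator (Z (suc i) (suc j)) + indicator (W i (suc j))
    Z-lower i j j<q with W (suc i) (suc j) in eq | W i (suc j) in eq′
    ... | true  | true  = +-monoˡ-≤ 1# (indicator-mono Z-keep)
    ... | false | b     = +-mono-≤ (indicator-mono Z-keep) (indicator-mono {false} {b} λ ())
    -- A newly used column carries the 1 of the row, so nothing lies further right and both sides
    -- equal 1.
    ... | true  | false
      rewrite Z-new j<q eq eq′
            | ¬-not {Z (suc i) (suc (suc j))}
                (λ e → contradiction (≡.trans (≡.sym eq′) (W-open (Z-used e))) λ ())
      = ≤-reflexive (+-comm 0# 1#)

  -- Shaped so that `ConvexHull K (Vertex R)` unfolds to either orbitope, according to `R`.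
  Vertex : (Matrix p q → Set) → Pred (Space K (𝓘 p q)) ℓ₁
  Vertex R x = ∃[ A ] ColumnsDecreasing A × R A × _≋_ K x (restrict K p q A)

  difference : (ℕ → ℕ → Carrier) → Space K (𝓘 p q)
  difference Z e = let open 𝓘 e in Z i j - Z i (suc j)

  -- Sampling

  _≟ᶜ_ : DecidableEquality Coordinate
  _≟ᶜ_ = ⊎-≡-dec (×-≡-dec ℕ._≟_ ℕ._≟_) (×-≡-dec ℕ._≟_ ℕ._≟_)

  module Sampling {W Z : ℕ → ℕ → Carrier} (feasible : Feasible W Z) where

    open Feasible feasible
    open FromBits q
    open Weights using (hi; mean; mean-cong)

    lower : ℕ → ℕ → Carrier
    lower i j = Z (suc i) (suc (suc j)) + W (suc i) (suc j) - W i (suc j)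

    weights : Coordinate → Weights
    weights (inj₁ (i , j)) = proj₁ (interpolate (W i (suc j)) (W (suc i) (suc j)) (W i j))
    weights (inj₂ (i , j)) = proj₁ (interpolate (lower i j) (Z (suc i) (suc j)) (W (suc i) (suc j)))

    open Expectation _≟ᶜ_ weights

    -- `E-hull` quantifies over all values of the listed bits, even those of probability 0. Dropping
    -- the coordinates with `hi ≈ 1#` turns "set almost surely" into "set".
    coordinates undetermined : List Coordinate
    coordinates = map inj₁ (cartesianProduct (upTo p) (upTo q)) ++
                  map inj₂ (cartesianProduct (upTo p) (upTo q))

    undetermined = filter (λ x → ¬? (hi (weights x) ≟ 1#)) coordinates

    ∈-coordinates₁ : ∀ {i j} → i ℕ.< p → j ℕ.< q → inj₁ (i , j) ∈ˡ coordinates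
    ∈-coordinates₁ i<p j<q =
      ∈-++⁺ˡ (∈-map⁺ inj₁ (∈-cartesianProduct⁺ (∈-upTo⁺ i<p) (∈-upTo⁺ j<q)))

    ∈-coordinates₂ : ∀ {i j} → i ℕ.< p → j ℕ.< q → inj₂ (i , j) ∈ˡ coordinates
    ∈-coordinates₂ i<p j<q = ∈-++⁺ʳ (map inj₁ (cartesianProduct (upTo p) (upTo q)))
      (∈-map⁺ inj₂ (∈-cartesianProduct⁺ (∈-upTo⁺ i<p) (∈-upTo⁺ j<q)))

    ∈-undetermined : ∀ {x} → x ∈ˡ coordinates → x ∈ˡ undetermined ⊎ hi (weights x) ≈ 1#
    ∈-undetermined {x} x∈ with hi (weights x) ≟ 1#
    ... | yes hi≈1 = inj₂ hi≈1
    ... | no  hi≉1 = inj₁ (∈-filter⁺ _ x∈ hi≉1)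

    ∉-undetermined : ∀ {x} → hi (weights x) ≈ 1# → x ∉ undetermined
    ∉-undetermined hi≈1 x∈ =
      proj₂ (∈-filter⁻ (λ x → ¬? (hi (weights x) ≟ 1#)) {xs = coordinates} x∈) hi≈1

    𝔼 : (Bits → Bool) → Carrier
    𝔼 f = E undetermined (indicator ∘ f)

    open Linear (E-linear undetermined) using (homo-+; homo-neg) renaming (cong to 𝔼-cong)

    -- Induction on rows: both bounds read only bits of earlier rows, so `E-choose` yields the mean
    -- of their expectations, and the weights were chosen to make this mean `W (suc i) (suc j)`.
    𝔼-W : ∀ i j → i ℕ.≤ p → j ℕ.≤ q → 𝔼 (λ b → Wᵇ b i j) ≈ W i j
    𝔼-W i       zero    _   _   = trans (E-const undetermined 1#) (sym (W-left i))
    𝔼-W zero    (suc j) _   _   = trans (E-const undetermined 0#) (sym (W-first j))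
    𝔼-W (suc i) (suc j) i<p j<q = begin-equality
      𝔼 (λ b → Wᵇ b (suc i) (suc j))
        ≈⟨ E-choose undetermined (∈-undetermined (∈-coordinates₁ i<p j<q)) (ignores (suc j)) (ignores j) ⟩
      mean w (𝔼 (λ b → Wᵇ b i (suc j))) (𝔼 (λ b → Wᵇ b i j))
        ≈⟨ mean-cong w (𝔼-W i (suc j) (ℕ.<⇒≤ i<p) j<q) (𝔼-W i j (ℕ.<⇒≤ i<p) (ℕ.<⇒≤ j<q)) ⟩
      mean w (W i (suc j)) (W i j)
        ≈⟨ proj₁ (proj₂ (interpolate _ _ _)) (W-lower i<p j<q) (W-upper i<p j<q) ⟩
      W (suc i) (suc j) ∎
      where
      w = weights (inj₁ (i , j))
      ignores : ∀ j′ → Ignores (inj₁ (i , j)) (λ b → Wᵇ b i j′)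
      ignores j′ h = Wᵇ-local i j′ λ i′<i → h λ { ≡.refl → ℕ.<-irrefl ≡.refl i′<i }

    -- The same argument within a row, from the right end inwards; `k` counts the columns from `j`
    -- on.
    𝔼-tail : ∀ {i} k j → i ℕ.< p → k ℕ.+ j ≡ q → 𝔼 (tailᵇ i k j) ≈ Z (suc i) (suc j)
    𝔼-tail {i} zero    j i<p ≡.refl = trans (E-const undetermined 0#) (sym (Z-last i))
    𝔼-tail {i} (suc k) j i<p ≡.refl = begin-equality
      𝔼 (tailᵇ i (suc k) j)
        ≈⟨ E-choose undetermined (∈-undetermined (∈-coordinates₂ i<p j<q)) ignores-lower ignores-upper ⟩
      mean w (𝔼 (lowerᵇ i k j)) (𝔼 (λ b → Wᵇ b (suc i) (suc j)))
        ≈⟨ mean-cong w 𝔼-lower (𝔼-W (suc i) (suc j) i<p j<q) ⟩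
      mean w (lower i j) (W (suc i) (suc j))
        ≈⟨ proj₁ (proj₂ (interpolate _ _ _)) lower≤Z (Z-upper i<p j<q) ⟩
      Z (suc i) (suc j) ∎
      where
      j<q : j ℕ.< q
      j<q = ℕ.s≤s (ℕ.m≤n+m j k)

      w = weights (inj₂ (i , j))

      lower≤Z : lower i j ≤ Z (suc i) (suc j)
      lower≤Z = +-cancelʳ-≤ (W i (suc j)) (≤-respˡ-≈ (sym (x-y+y≈x _ _)) (Z-lower i<p j<q))

      ignores-upper : Ignores (inj₂ (i , j)) (λ b → Wᵇ b (suc i) (suc j))
      ignores-upper h = Wᵇ-local (suc i) (suc j) λ _ → h λ ()

      ignores-lower : Ignores (inj₂ (i , j)) (lowerᵇ i k j)
      ignores-lower h = ≡.cong₂ _∨_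
        (tailᵇ-local i k (suc j) (h λ ()) λ j<j′ → h λ { ≡.refl → ℕ.<-irrefl ≡.refl j<j′ })
        (≡.cong₂ (λ x y → x ∧ not y) (Wᵇ-local (suc i) (suc j) λ _ → h λ ())
                                     (Wᵇ-local i (suc j) λ _ → h λ ()))

      -- The events involved are dependent, but `indicator-lower` makes the bound affine in their
      -- indicators, so linearity suffices.
      𝔼-lower : 𝔼 (lowerᵇ i k j) ≈ lower i j
      𝔼-lower = +-cancelʳ-≈ (W i (suc j)) (begin-equality
        𝔼 (lowerᵇ i k j) + W i (suc j)
          ≈⟨ +-congˡ (𝔼-W i (suc j) (ℕ.<⇒≤ i<p) j<q) ⟨
        𝔼 (lowerᵇ i k j) + 𝔼 (λ b → Wᵇ b i (suc j))
          ≈⟨ homo-+ _ _ ⟨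
        E undetermined (λ b → indicator (lowerᵇ i k j b) + indicator (Wᵇ b i (suc j)))
          ≈⟨ 𝔼-cong (λ b → indicator-lower (Wᵇ-keep b i (suc j))
               (Wᵇ-open b i (suc j) ∘ tailᵇ-used b i k (suc j))) ⟩
        E undetermined (λ b → indicator (tailᵇ i k (suc j) b) + indicator (Wᵇ b (suc i) (suc j)))
          ≈⟨ homo-+ _ _ ⟩
        𝔼 (tailᵇ i k (suc j)) + 𝔼 (λ b → Wᵇ b (suc i) (suc j))
          ≈⟨ +-cong (𝔼-tail k (suc j) i<p (ℕ.+-suc k j)) (𝔼-W (suc i) (suc j) i<p j<q) ⟩
        Z (suc i) (suc (suc j)) + W (suc i) (suc j)
          ≈⟨ x-y+y≈x _ _ ⟨
        lower i j + W i (suc j) ∎)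

    𝔼-Z : ∀ {i j} → i ℕ.< p → j ℕ.≤ q → 𝔼 (λ b → Zᵇ b (suc i) (suc j)) ≈ Z (suc i) (suc j)
    𝔼-Z {j = j} i<p j≤q = 𝔼-tail (q ℕ.∸ j) j i<p (ℕ.m∸n+n≡m j≤q)

    sample : Bits → Matrix p q
    sample b = matrix (isPatternᵇ b) p

    𝔼-sample : ∀ e → E undetermined (λ b → restrict K p q (sample b) e) ≈ difference Z e
    𝔼-sample e@(entry r c _) = begin-equality
      E undetermined (λ b → restrict K p q (sample b) e)
        ≈⟨ 𝔼-cong (λ b → indicator-∧-not _ _ (IsPattern.Z-keep (isPatternᵇ b))) ⟩
      E undetermined (λ b → indicator (Zᵇ b i j) - indicator (Zᵇ b i (suc j)))
        ≈⟨ homo-+ _ _ ⟩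
      𝔼 (λ b → Zᵇ b i j) + E undetermined (λ b → - indicator (Zᵇ b i (suc j)))
        ≈⟨ +-congˡ (homo-neg _) ⟩
      𝔼 (λ b → Zᵇ b i j) - 𝔼 (λ b → Zᵇ b i (suc j))
        ≈⟨ +-cong (𝔼-Z (toℕ<n r) (ℕ.<⇒≤ (toℕ<n c))) (-‿cong (𝔼-Z (toℕ<n r) (toℕ<n c))) ⟩
      Z i j - Z i (suc j) ∎
      where
      i = suc (toℕ r)
      j = suc (toℕ c)

    difference∈hull : (R : Matrix p q → Set) →
      (∀ b → (∀ x → x ∉ undetermined → b x ≡ true) → R (sample b)) →
      difference Z ∈ ConvexHull K (Vertex R)
    difference∈hull R h = hull-resp {S = Vertex R} 𝔼-sample
      (E-hull undetermined (λ b → restrict K p q (sample b)) {Vertex R} λ b determined →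
        hull-inj {S = Vertex R}
          (sample b , matrix-columnsDecreasing (isPatternᵇ b) p , h b determined , λ _ → refl))

    difference∈packing : difference Z ∈ PackingOrbitope K p q
    difference∈packing =
      difference∈hull AtMostOnePerRow λ b _ → matrix-atMostOne (isPatternᵇ b) p

    -- In column 1 both coordinates equal their upper bounds `W i 0` and `W (suc i) 1`, so their
    -- bits are always set and `Zᵇ-full` applies to every sample.
    difference∈partitioning : 1 ℕ.≤ q →
      (∀ {i} → i ℕ.< p → W (suc i) 1 ≈ 1#) → (∀ {i} → i ℕ.< p → Z (suc i) 1 ≈ W (suc i) 1) →
      difference Z ∈ PartitioningOrbitope K p q
    difference∈partitioning 1≤q W≈1 Z≈W =
      difference∈hull ExactlyOnePerRow λ b determined →
        matrix-exactlyOne (isPatternᵇ b) p λ {i} i<p → Zᵇ-full b i 1≤q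
          (determined _ (∉-undetermined (proj₂ (proj₂ (interpolate _ _ _))
            (trans (W≈1 i<p) (sym (W-left i))))))
          (determined _ (∉-undetermined (proj₂ (proj₂ (interpolate _ _ _)) (Z≈W i<p))))

  -- Reading entries

  read : Space K (𝓘 p q) → ℕ → ℕ → Carrier
  read = _⟨_,_⟩ K p q

  entry-cong : ∀ {r r′ c c′} .{h : toℕ c ℕ.≤ toℕ r} .{h′ : toℕ c′ ℕ.≤ toℕ r′} →
    r ≡ r′ → c ≡ c′ → entry {p} {q} r c h ≡ entry r′ c′ h′
  entry-cong ≡.refl ≡.refl = ≡.refl

  read-entry : ∀ v e → read v (𝓘.i e) (𝓘.j e) ≡ v e
  read-entry v (entry r c c≤r) with toℕ r ℕ.<? p | toℕ c ℕ.<? q | toℕ c ℕ.≤? toℕ r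
  ... | yes r<p | yes c<q | yes _  = ≡.cong v (entry-cong (fromℕ<-toℕ r r<p) (fromℕ<-toℕ c c<q))
  ... | no r≮p  | _       | _      = contradiction (toℕ<n r) r≮p
  ... | yes _   | no c≮q  | _      = contradiction (toℕ<n c) c≮q
  ... | yes _   | yes _   | no c≰r = ⊥-elim-irr (c≰r c≤r)

  read-linear : ∀ i j → Linear (λ v → read v i j)
  read-linear zero    _       = linear-0
  read-linear (suc i) zero    = linear-0
  read-linear (suc i) (suc j) with i ℕ.<? p | j ℕ.<? q | j ℕ.≤? i
  ... | yes _ | yes _ | yes _ = coordinate _
  ... | no _  | _     | _     = linear-0
  ... | yes _ | no _  | _     = linear-0
  ... | yes _ | yes _ | no _  = linear-0

  read-above : ∀ v {i j} → i ℕ.≤ j → read v i (suc j) ≡ 0#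
  read-above v {zero}  _ = ≡.refl
  read-above v {suc i} {j} i<j with i ℕ.<? p | j ℕ.<? q | j ℕ.≤? i
  ... | yes _ | yes _ | yes j≤i = contradiction i<j (ℕ.≤⇒≯ j≤i)
  ... | no _  | _     | _       = ≡.refl
  ... | yes _ | no _  | _       = ≡.refl
  ... | yes _ | yes _ | no _    = ≡.refl

  read-beyond : ∀ v i {j} → q ℕ.≤ j → read v i (suc j) ≡ 0#
  read-beyond v zero    _ = ≡.refl
  read-beyond v (suc i) {j} q≤j with i ℕ.<? p | j ℕ.<? q | j ℕ.≤? i
  ... | yes _ | yes j<q | yes _ = contradiction j<q (ℕ.≤⇒≯ q≤j)
  ... | no _  | _       | _     = ≡.refl
  ... | yes _ | no _    | _     = ≡.refl
  ... | yes _ | yes j<q | no _  = contradiction j<q (ℕ.≤⇒≯ q≤j)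

  write : (ℕ → ℕ → Carrier) → Space K (𝓘 p q)
  write F e = F (𝓘.i e) (𝓘.j e)

  read-write : ∀ {F} → (∀ {i j} → i ℕ.< j → F (suc i) (suc j) ≈ 0#) →
    ∀ {i j} → i ℕ.< p → j ℕ.< q → read (write F) (suc i) (suc j) ≈ F (suc i) (suc j)
  read-write {F} F-above {i} {j} i<p j<q with i ℕ.<? p | j ℕ.<? q | j ℕ.≤? i
  ... | yes i<p | yes j<q | yes _   =
    reflexive (≡.cong₂ (λ i j → F (suc i) (suc j)) (toℕ-fromℕ< i<p) (toℕ-fromℕ< j<q))
  ... | no i≮p  | _       | _       = contradiction i<p i≮p
  ... | yes _   | no j≮q  | _       = contradiction j<q j≮q
  ... | yes _   | yes _   | no j≰i  = sym (F-above (ℕ.≰⇒> j≰i))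

  entrywise : ∀ {ℓ} (Q : ℕ → ℕ → Set ℓ) → (∀ e → Q (𝓘.i e) (𝓘.j e)) →
    ∀ {i j} → i ℕ.< p → j ℕ.< q → j ℕ.≤ i → Q (suc i) (suc j)
  entrywise Q h {i} {j} i<p j<q j≤i =
    ≡.subst₂ (λ i j → Q (suc i) (suc j)) (toℕ-fromℕ< i<p) (toℕ-fromℕ< j<q)
      (h (entry (fromℕ< i<p) (fromℕ< j<q)
        (≡.subst₂ ℕ._≤_ (≡.sym (toℕ-fromℕ< j<q)) (≡.sym (toℕ-fromℕ< i<p)) j≤i)))

  -- Equivalence of feasibility and the compact system

  Point : Set c
  Point = Space K (𝓘 p q ⊎ 𝓘 p q)

  -- `read` would give 0 in column 0; the value 1 there makes the bound `w ≤ 1` the first case of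
  -- the diagonal inequality.
  Zᵛ Wᵛ : Point → ℕ → ℕ → Carrier
  Zᵛ v = read (v ∘ inj₁)
  Wᵛ v i zero    = 1#
  Wᵛ v i (suc j) = read (v ∘ inj₂) i (suc j)

  compact⇒feasible : ∀ {v} → 1 ℕ.≤ q → v ∈ CompactPolytope K p q → Feasible (Wᵛ v) (Zᵛ v)
  compact⇒feasible {v} 1≤q sys = record
    { W-left  = λ _ → refl
    ; W-first = λ _ → refl
    ; Z-last  = λ i → reflexive (read-beyond z (suc i) ℕ.≤-refl)
    ; W-lower = W-lower _ _
    ; W-upper = W-upper _ _
    ; Z-lower = Z-lower _ _
    ; Z-upper = Z-upper _ _
    }
    where
    open CompactSystem sys
    z = v ∘ inj₁
    w = v ∘ inj₂

    W-lower : ∀ i j → i ℕ.< p → j ℕ.< q → read w i (suc j) ≤ read w (suc i) (suc j)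
    W-lower i j i<p j<q with ℕ.≤-<-connex j i
    ... | inj₁ j≤i = 0≤y-x⇒x≤y (w-vertical i j i<p (ℕ.⊓-glb (ℕ.s≤s j≤i) j<q))
    ... | inj₂ i<j = ≤-reflexive (reflexive (≡.trans (read-above w (ℕ.<⇒≤ i<j))
                                                    (≡.sym (read-above w i<j))))

    -- Column 1 increases with the row, so `w-top`, stated for row `p` only, bounds all of it.
    first-column : ∀ k i → k ℕ.+ suc i ≡ p → read w (suc i) 1 ≤ 1#
    first-column zero    i ≡.refl = w-top
    first-column (suc k) i ≡.refl = ≤-trans
      (W-lower (suc i) 0 (ℕ.s≤s (ℕ.m≤n+m (suc i) k)) 1≤q)
      (first-column k (suc i) (ℕ.+-suc k (suc i)))

    W-upper : ∀ i j → i ℕ.< p → j ℕ.< q → read w (suc i) (suc j) ≤ Wᵛ v i j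
    W-upper i       zero    i<p _ = first-column (p ℕ.∸ suc i) i (ℕ.m∸n+n≡m i<p)
    W-upper i (suc j) i<p j<q with ℕ.≤-<-connex (suc j) i
    W-upper (suc i) (suc j) i<p j<q | inj₁ (ℕ.s≤s j≤i) = 0≤y-x⇒x≤y
      (entrywise (λ i j → i ℕ.< p → 0# ≤ read w i j - read w (suc i) (suc j)) w-diagonal
        (ℕ.<⇒≤ i<p) (ℕ.<⇒≤ j<q) j≤i i<p)
    ... | inj₂ i≤j = ≤-reflexive (reflexive (≡.trans (read-above w i≤j)
                                                   (≡.sym (read-above w (ℕ.s≤s⁻¹ i≤j)))))

    Z-lower : ∀ i j → i ℕ.< p → j ℕ.< q →
      read z (suc i) (suc (suc j)) + read w (suc i) (suc j) ≤ read z (suc i) (suc j) + read w i (suc j)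
    Z-lower i j i<p j<q with ℕ.≤-<-connex j i
    ... | inj₁ j≤i = transpose⁺
      (entrywise (λ i j → read w i j - read w (ℕ.pred i) j - read z i j + read z i (suc j) ≤ 0#)
        zw-lower i<p j<q j≤i)
    ... | inj₂ i<j = ≤-reflexive (reflexive (≡.cong₂ _+_
      (≡.trans (read-above z (ℕ.m≤n⇒m≤1+n i<j)) (≡.sym (read-above z i<j)))
      (≡.trans (read-above w i<j) (≡.sym (read-above w (ℕ.<⇒≤ i<j))))))

    Z-upper : ∀ i j → i ℕ.< p → j ℕ.< q → read z (suc i) (suc j) ≤ read w (suc i) (suc j)
    Z-upper i j i<p j<q with ℕ.≤-<-connex j i
    ... | inj₁ j≤i = x-y≤0⇒x≤y (entrywise (λ i j → read z i j - read w i j ≤ 0#) zw-upper i<p j<q j≤i)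
    ... | inj₂ i<j = ≤-reflexive (reflexive
      (≡.trans (read-above z i<j) (≡.sym (read-above w i<j))))

  feasible⇒compact : ∀ {v} → 1 ℕ.≤ q → Feasible (Wᵛ v) (Zᵛ v) → v ∈ CompactPolytope K p q
  feasible⇒compact {v} 1≤q feasible = record
    { w-vertical = λ i j i<p j<cap → x≤y⇒0≤y-x (W-lower i<p (ℕ.<-≤-trans j<cap (ℕ.m⊓n≤n (suc i) q)))
    ; w-diagonal = λ e i<p → x≤y⇒0≤y-x (w-diagonal e i<p)
    ; w-top      = W-≤1 p 1 ℕ.≤-refl 1≤q
    ; zw-lower   = λ (entry r c _) → transpose⁻ (Z-lower (toℕ<n r) (toℕ<n c))
    ; zw-upper   = λ (entry r c _) → x≤y⇒x-y≤0 (Z-upper (toℕ<n r) (toℕ<n c))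
    ; w-nonNeg   = λ i _ i≤p → read-nonNeg i (cap K p q i) i≤p (ℕ.m⊓n≤n i q)
    }
    where
    open Feasible feasible
    w = v ∘ inj₂

    read-nonNeg : ∀ i j → i ℕ.≤ p → j ℕ.≤ q → 0# ≤ read w i j
    read-nonNeg zero    _       _   _   = ≤-refl
    read-nonNeg (suc i) zero    _   _   = ≤-refl
    read-nonNeg (suc i) (suc j) i≤p j≤q = W-nonNeg (suc i) (suc j) i≤p j≤q

    w-diagonal : ∀ e → let open 𝓘 e in i ℕ.< p → read w (suc i) (suc j) ≤ read w i j
    w-diagonal (entry r c _) i<p with ℕ.<-≤-connex (suc (toℕ c)) q
    ... | inj₁ j<q = W-upper i<p j<q
    -- In the last column the diagonal neighbour is read as 0, and the inequality becomes
    -- nonnegativity.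
    ... | inj₂ q≤j = ≤-respˡ-≈ (reflexive (≡.sym (read-beyond w (suc (suc (toℕ r))) q≤j)))
      (read-nonNeg (suc (toℕ r)) (suc (toℕ c)) (ℕ.<⇒≤ i<p) (toℕ<n c))

  -- On the face w₁₁ = 1 the system leaves z i 1 free below w i 1 = 1, so the
  -- projection onto the partitioning orbitope uses w i 1 in its place.
  raise : (W Z : ℕ → ℕ → Carrier) → ℕ → ℕ → Carrier
  raise W Z i (suc zero) = W i 1
  raise W Z i j          = Z i j

  raise-≈ : ∀ {W Z} i → W i 1 ≈ Z i 1 → ∀ j → raise W Z i j ≈ Z i j
  raise-≈ i W≈Z zero          = refl
  raise-≈ i W≈Z (suc zero)    = W≈Z
  raise-≈ i W≈Z (suc (suc j)) = refl

  -- An entry of column 1 of `Z` occurs only on the larger side of `Z-lower`, so it may grow up to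
  -- the bound in `Z-upper`.
  raise-feasible : ∀ {W Z} → 1 ℕ.≤ q → Feasible W Z → Feasible W (raise W Z)
  raise-feasible {W} {Z} (ℕ.s≤s _) feasible = record
    { W-left  = W-left
    ; W-first = W-first
    -- Matching on `1 ≤ q` shows that column `suc q` is at least 2, where `raise` changes nothing.
    ; Z-last  = Z-last
    ; W-lower = W-lower
    ; W-upper = W-upper
    ; Z-lower = raise-lower _ _
    ; Z-upper = raise-upper _ _
    }
    where
    open Feasible feasible
    raise-lower : ∀ i j → i ℕ.< p → j ℕ.< q →
      Z (suc i) (suc (suc j)) + W (suc i) (suc j) ≤ raise W Z (suc i) (suc j) + W i (suc j)
    raise-lower i zero    i<p j<q = ≤-trans (Z-lower i<p j<q) (+-monoˡ-≤ _ (Z-upper i<p j<q))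
    raise-lower i (suc j) i<p j<q = Z-lower i<p j<q
    raise-upper : ∀ i j → i ℕ.< p → j ℕ.< q → raise W Z (suc i) (suc j) ≤ W (suc i) (suc j)
    raise-upper i zero    i<p j<q = ≤-refl
    raise-upper i (suc j) i<p j<q = Z-upper i<p j<q

  -- The compact polytope

  Z-linear : ∀ i j → Linear (λ v → Zᵛ v i j)
  Z-linear i j = linear-∘ (read-linear i j) λ e → coordinate (inj₁ e)

  W-linear : ∀ i j → Linear (λ v → Wᵛ v i (suc j))
  W-linear i j = linear-∘ (read-linear i (suc j)) λ e → coordinate (inj₂ e)

  raise-linear : ∀ i j → Linear (λ v → raise (Wᵛ v) (Zᵛ v) i j)
  raise-linear i zero          = Z-linear i zero
  raise-linear i (suc zero)    = W-linear i 0
  raise-linear i (suc (suc j)) = Z-linear i (suc (suc j))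

  -- Feasibility is indexed by a full rectangle, so two bounded quantifiers over blocks of four
  -- inequalities describe the polytope.
  compact-isPolyhedron : 1 ℕ.≤ q → IsPolyhedron K (CompactPolytope K p q)
  compact-isPolyhedron 1≤q = polyhedron-resp
    (λ v → mk⇔ (feasible⇒compact {v} 1≤q ∘ feasible v) (inequalities v ∘ compact⇒feasible {v} 1≤q))
    (polyhedron-∀< p {λ i v → ∀ {j} → j ℕ.< q → Inequalities i j v} λ i →
     polyhedron-∀< q {λ j v → Inequalities i j v} λ j →
       polyhedron-∩ (polyhedron-≤ (W-linear i j) (W-linear (suc i) j))
       (polyhedron-∩ (W-upper-isPolyhedron i j)
       (polyhedron-∩ (polyhedron-≤ (linear-+ (Z-linear (suc i) (suc (suc j))) (W-linear (suc i) j))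
                                   (linear-+ (Z-linear (suc i) (suc j)) (W-linear i j)))
                     (polyhedron-≤ (Z-linear (suc i) (suc j)) (W-linear (suc i) j)))))
    where
    Inequalities : ℕ → ℕ → Pred Point ℓ₂
    Inequalities i j v =
      Wᵛ v i (suc j) ≤ Wᵛ v (suc i) (suc j) ×
      Wᵛ v (suc i) (suc j) ≤ Wᵛ v i j ×
      Zᵛ v (suc i) (suc (suc j)) + Wᵛ v (suc i) (suc j) ≤ Zᵛ v (suc i) (suc j) + Wᵛ v i (suc j) ×
      Zᵛ v (suc i) (suc j) ≤ Wᵛ v (suc i) (suc j)

    W-upper-isPolyhedron : ∀ i j → IsPolyhedron K (λ v → Wᵛ v (suc i) (suc j) ≤ Wᵛ v i j)
    W-upper-isPolyhedron i zero    = polyhedron-≤const (W-linear (suc i) 0) 1#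
    W-upper-isPolyhedron i (suc j) = polyhedron-≤ (W-linear (suc i) (suc j)) (W-linear i j)

    feasible : ∀ v → (∀ {i} → i ℕ.< p → ∀ {j} → j ℕ.< q → Inequalities i j v) →
               Feasible (Wᵛ v) (Zᵛ v)
    feasible v h = record
      { W-left  = λ _ → refl
      ; W-first = λ _ → refl
      ; Z-last  = λ i → reflexive (read-beyond (v ∘ inj₁) (suc i) ℕ.≤-refl)
      ; W-lower = λ i<p j<q → proj₁ (h i<p j<q)
      ; W-upper = λ i<p j<q → proj₁ (proj₂ (h i<p j<q))
      ; Z-lower = λ i<p j<q → proj₁ (proj₂ (proj₂ (h i<p j<q)))
      ; Z-upper = λ i<p j<q → proj₂ (proj₂ (proj₂ (h i<p j<q)))
      }

    inequalities : ∀ v → Feasible (Wᵛ v) (Zᵛ v) →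
                   ∀ {i} → i ℕ.< p → ∀ {j} → j ℕ.< q → Inequalities i j v
    inequalities v f i<p j<q = W-lower i<p j<q , W-upper i<p j<q , Z-lower i<p j<q , Z-upper i<p j<q
      where open Feasible f

  compact-isBounded : 1 ℕ.≤ q → IsBounded K (CompactPolytope K p q)
  compact-isBounded 1≤q = 1# , λ {v} v∈P e → bound v (compact⇒feasible {v} 1≤q v∈P) e
    where
    bound : ∀ v → Feasible (Wᵛ v) (Zᵛ v) → ∀ e → - 1# ≤ v e × v e ≤ 1#
    bound v f (inj₁ e@(entry r c _)) rewrite ≡.sym (read-entry (v ∘ inj₁) e) =
      ≤-trans -1≤0 (Z-nonNeg (q ℕ.∸ toℕ c) (toℕ c) (toℕ<n r) (ℕ.m∸n+n≡m (ℕ.<⇒≤ (toℕ<n c)))) ,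
      ≤-trans (Z-upper (toℕ<n r) (toℕ<n c)) (W-≤1 _ _ (toℕ<n r) (toℕ<n c))
      where open Feasible f
    bound v f (inj₂ e@(entry r c _)) rewrite ≡.sym (read-entry (v ∘ inj₂) e) =
      ≤-trans -1≤0 (W-nonNeg _ _ (toℕ<n r) (toℕ<n c)) , W-≤1 _ _ (toℕ<n r) (toℕ<n c)
      where open Feasible f

  -- Integral points

  module _ {W Z : ℕ → ℕ → Bool} (pat : IsPattern q W Z) where

    open IsPattern pat
    open Feasible (pattern-feasible pat) using ()
      renaming (W-lower to W-lower′; W-upper to W-upper′; Z-lower to Z-lower′; Z-upper to Z-upper′)

    point : Point
    point = [ write (λ i j → indicator (Z i j)) , write (λ i j → indicator (W i j)) ]′

    W-point : ∀ i j → i ℕ.≤ p → j ℕ.≤ q → Wᵛ point i j ≈ indicator (W i j)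
    W-point i       zero    _   _   = reflexive (≡.sym (≡.cong indicator (W-left i)))
    W-point zero    (suc j) _   _   = reflexive (≡.sym (≡.cong indicator (W-first j)))
    W-point (suc i) (suc j) i<p j<q =
      read-write {λ i j → indicator (W i j)}
        (λ i<j → reflexive (≡.cong indicator (W-triangular i<j))) i<p j<q

    Z-point : ∀ i j → i ℕ.< p → j ℕ.≤ q → Zᵛ point (suc i) (suc j) ≈ indicator (Z (suc i) (suc j))
    Z-point i j i<p j≤q with ℕ.m≤n⇒m<n∨m≡n j≤q
    ... | inj₁ j<q = read-write {λ i j → indicator (Z i j)}
        (λ i<j → reflexive (≡.cong indicator (Z-triangular i<j))) i<p j<q
    ... | inj₂ ≡.refl = reflexive (≡.trans (read-beyond (point ∘ inj₁) (suc i) ℕ.≤-refl)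
                                           (≡.sym (≡.cong indicator (Z-last i))))

    point∈compact : 1 ℕ.≤ q → point ∈ CompactPolytope K p q
    point∈compact 1≤q = feasible⇒compact {point} 1≤q record
      { W-left  = λ _ → refl
      ; W-first = λ _ → refl
      ; Z-last  = λ i → reflexive (read-beyond (point ∘ inj₁) (suc i) ℕ.≤-refl)
      ; W-lower = λ i<p j<q → ≤-resp-≈ (sym (W-point _ _ (ℕ.<⇒≤ i<p) j<q)) (sym (W-point _ _ i<p j<q))
                                (W-lower′ i<p j<q)
      ; W-upper = λ i<p j<q → ≤-resp-≈ (sym (W-point _ _ i<p j<q)) (sym (W-point _ _ (ℕ.<⇒≤ i<p) (ℕ.<⇒≤ j<q)))
                                (W-upper′ i<p j<q)
      ; Z-lower = λ i<p j<q → ≤-resp-≈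
                                (+-cong (sym (Z-point _ _ i<p j<q)) (sym (W-point _ _ i<p j<q)))
                                (+-cong (sym (Z-point _ _ i<p (ℕ.<⇒≤ j<q))) (sym (W-point _ _ (ℕ.<⇒≤ i<p) j<q)))
                                (Z-lower′ i<p j<q)
      ; Z-upper = λ i<p j<q → ≤-resp-≈ (sym (Z-point _ _ i<p (ℕ.<⇒≤ j<q))) (sym (W-point _ _ i<p j<q))
                                (Z-upper′ i<p j<q)
      }

  module FromVertex (A : Matrix p q) (dec : ColumnsDecreasing A) (one : AtMostOnePerRow A) where

    open FromMarks q (at A) (at-ordered A one dec) (at-unique A one) (at-range A)

    lift : Point
    lift = point isPattern

    lift∈compact : 1 ℕ.≤ q → lift ∈ CompactPolytope K p q
    lift∈compact = point∈compact isPattern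

    -- By `right-step` an entry of `right` is the mark joined to the next entry; one 1 per row makes
    -- the two exclusive, so subtracting leaves the mark.
    lift-difference : ∀ {x} → _≋_ K x (restrict K p q A) → _≋_ K (difference (Zᵛ lift)) x
    lift-difference {x} x≋A e@(entry r c _) = begin-equality
      Zᵛ lift i j - Zᵛ lift i (suc j)
        ≈⟨ +-cong (Z-point isPattern _ _ (toℕ<n r) (ℕ.<⇒≤ (toℕ<n c)))
                  (-‿cong (Z-point isPattern _ _ (toℕ<n r) (toℕ<n c))) ⟩
      indicator (right i j) - indicator (right i (suc j))
        ≈⟨ +-congʳ (reflexive (≡.cong indicator (right-step (toℕ r) (toℕ<n c)))) ⟩
      indicator (at A (toℕ r) (toℕ c) ∨ right i (suc j)) - indicator (right i (suc j))
        ≈⟨ indicator-∨ _ right-disjoint ⟩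
      indicator (at A (toℕ r) (toℕ c))
        ≈⟨ reflexive (≡.cong indicator (at-toℕ A r c)) ⟩
      restrict K p q A e
        ≈⟨ x≋A e ⟨
      x e ∎
      where
      i = suc (toℕ r)
      j = suc (toℕ c)
      indicator-∨ : ∀ a {b} → (a ≡ true → b ≡ false) → indicator (a ∨ b) - indicator b ≈ indicator a
      indicator-∨ true  disjoint rewrite disjoint ≡.refl = trans (+-congˡ -0≈0) (+-identityʳ 1#)
      indicator-∨ false {b} _ = -‿inverseʳ (indicator b)

    module _ (full : ∀ r → ∃[ c ] A r c ≡ true) where

      right≡true : ∀ {i} → i ℕ.< p → right (suc i) 1 ≡ true
      right≡true i<p = let c , a = full (fromℕ< i<p) in
        ≡.subst (λ i → right (suc i) 1 ≡ true) (toℕ-fromℕ< i<p)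
          (right-full (≡.trans (at-toℕ A (fromℕ< i<p) c) a))

      lift-W≈1 : ∀ {i} → 1 ℕ.≤ q → i ℕ.< p → Wᵛ lift (suc i) 1 ≈ 1#
      lift-W≈1 1≤q i<p = trans (W-point isPattern _ 1 i<p 1≤q)
        (reflexive (≡.cong indicator (IsPattern.Z-used isPattern (right≡true i<p))))

      lift-Z≈1 : ∀ {i} → i ℕ.< p → Zᵛ lift (suc i) 1 ≈ 1#
      lift-Z≈1 i<p = trans (Z-point isPattern _ 0 i<p ℕ.z≤n)
        (reflexive (≡.cong indicator (right≡true i<p)))

  -- The two extended formulations

  module _ (1≤q : 1 ℕ.≤ q) where

    compact-isPolytope : IsPolytope K (CompactPolytope K p q)
    compact-isPolytope = compact-isPolyhedron 1≤q , compact-isBounded 1≤q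

    packing : IsExtendedFormulation K (CompactPolytope K p q) (PackingOrbitope K p q)
    packing = extendedFormulation {S = Vertex AtMostOnePerRow} compact-isPolytope
      (difference ∘ Zᵛ)
      (λ e → let open 𝓘 e in linear-+ (Z-linear i j) (linear-neg (Z-linear i (suc j))))
      (λ (A , dec , one , x≋A) → let open FromVertex A dec one in
        lift , lift∈compact 1≤q , lift-difference x≋A)
      (λ {v} v∈P → Sampling.difference∈packing (compact⇒feasible {v} 1≤q v∈P))

    module _ (1≤p : 1 ℕ.≤ p) where

      w₁₁-valid : IsValid K (CompactPolytope K p q) (w₁₁ K p q) 1#
      w₁₁-valid = isLinearForm (W-linear 1 0) , λ {v} v∈P →
        Feasible.W-≤1 (compact⇒feasible {v} 1≤q v∈P) 1 1 1≤p 1≤q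

      face : Pred Point _
      face = Face K (CompactPolytope K p q) (w₁₁ K p q) 1#

      -- Since `w₁₁` is at most 1 on the polytope, adding the reverse inequality cuts out the face.
      face-isPolytope : IsPolytope K face
      face-isPolytope =
        polyhedron-resp
          (λ v → mk⇔ (λ (v∈P , 1≤w) → v∈P , antisym (proj₂ w₁₁-valid {v} v∈P) 1≤w)
                      (λ (v∈P , w≈1) → v∈P , ≤-reflexive (sym w≈1)))
          (polyhedron-∩ (compact-isPolyhedron 1≤q) (polyhedron-const≤ (W-linear 1 0) 1#)) ,
        proj₁ (compact-isBounded 1≤q) , λ {v} (v∈P , _) → proj₂ (compact-isBounded 1≤q) {v} v∈P

      -- Column 1 increases from `W 1 1` and stays at most 1.
      W≈1 : ∀ {W Z} → Feasible W Z → W 1 1 ≈ 1# → ∀ i → i ℕ.< p → W (suc i) 1 ≈ 1#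
      W≈1 f W₁₁≈1 zero    _     = W₁₁≈1
      W≈1 f W₁₁≈1 (suc i) i+1<p = antisym (W-≤1 (suc (suc i)) 1 i+1<p 1≤q)
        (≤-respˡ-≈ (W≈1 f W₁₁≈1 i (ℕ.<⇒≤ i+1<p)) (W-lower i+1<p 1≤q))
        where open Feasible f

      partitioning : IsExtendedFormulation K face (PartitioningOrbitope K p q)
      partitioning = extendedFormulation {S = Vertex ExactlyOnePerRow} face-isPolytope
        (λ v → difference (raise (Wᵛ v) (Zᵛ v)))
        (λ e → let open 𝓘 e in linear-+ (raise-linear i j) (linear-neg (raise-linear i (suc j))))
        (λ (A , dec , exact , x≋A) →
          let open FromVertex A dec (λ i a a′ →
                ≡.trans (≡.sym (proj₂ (proj₂ (exact i)) a)) (proj₂ (proj₂ (exact i)) a′))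
              full = λ i → proj₁ (exact i) , proj₁ (proj₂ (exact i))
              -- Every row of the matrix has a 1, so the lift has `w i 1 = z i 1 = 1` and raising
              -- leaves it unchanged.
              raise≈ = λ r → raise-≈ {Wᵛ lift} {Zᵛ lift} (suc (toℕ r))
                (trans (lift-W≈1 full 1≤q (toℕ<n r)) (sym (lift-Z≈1 full (toℕ<n r))))
          in lift , (lift∈compact 1≤q , lift-W≈1 full 1≤q 1≤p) , λ e@(entry r c _) → trans
               (+-cong (raise≈ r (suc (toℕ c))) (-‿cong (raise≈ r (suc (suc (toℕ c))))))
               (lift-difference x≋A e))
        (λ {v} (v∈P , w≈1) →
          let f = compact⇒feasible {v} 1≤q v∈P in
          Sampling.difference∈partitioning (raise-feasible 1≤q f) 1≤q
            -- The `refl` is the purpose of `raise`: column 1 of the raised `Z` is that of `W` by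
            -- definition.
            (λ {i} → W≈1 f w≈1 i) (λ _ → refl))

theorem10 : ∀ {c ℓ₁ ℓ₂} (K : OrderedField c ℓ₁ ℓ₂) (p q : ℕ) → 1 ≤ⁿ q → q ≤ⁿ p →
    IsExtendedFormulation K (CompactPolytope K p q) (PackingOrbitope K p q) ×
    IsValid K (CompactPolytope K p q) (w₁₁ K p q) (OrderedField.1# K) ×
    IsExtendedFormulation K (Face K (CompactPolytope K p q) (w₁₁ K p q) (OrderedField.1# K)) (PartitioningOrbitope K p q)
theorem10 K p q 1≤q q≤p = packing 1≤q , w₁₁-valid 1≤q 1≤p , partitioning 1≤q 1≤p
  where
  open Orbitopes K p q
  1≤p = ℕ.≤-trans 1≤q q≤p
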